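{- For every fixed positive integer $m$, as $n\to\infty$, $$\alpha(m,n)=\Theta\!\left(\frac{\alpha(m,1)^n}{n^{\lfloor\frac{m-1}{2}\rfloor+\frac12}}\right),$$ that is, there exist constants $0<c_1\le c_2$ depending only on $m$ such that $c_1\frac{\alpha(m,1)^n}{n^{\lfloor (m-1)/2\rfloor+1/2}}\le \alpha(m,n)\le c_2\frac{\alpha(m,1)^n}{n^{\lfloor (m-1)/2\rfloor+1/2}}$ for all sufficiently large $n$. Here $\alpha(2t-1,1)=\alpha(2t,1)=\binom{2t}{t}$ for every positive integer $t$.
   Context: For positive integers $m,n$, let $A(m,n)$ be the set of all $m\times n$ matrices with every entry in $\{1,-1\}$ such that every row sum and every column sum has absolute value at most $1$, and let $\alpha(m,n)=|A(m,n)|$. -}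

module Defs where

open import Data.Nat using (ℕ; zero; suc; _≤_; _≤?_)
open import Data.Integer using (ℤ; +_; -_; _+_; ∣_∣)
open import Data.List using (List; []; _∷_; [_]; map; concatMap; filter; length)
open import Data.Vec using (Vec; []; _∷_; transpose; foldr)
open import Data.Vec.Relation.Unary.All using (All; all?)
open import Data.Product using (_×_)
open import Relation.Nullary.Decidable using (Dec; _×-dec_)
open import Data.Rational using (ℚ; _/_)

data PM : Set where
  plus1 minus1 : PM

val : PM → ℤ
val plus1 = + 1
val minus1 = - (+ 1)

vsum : ∀ {n} → Vec PM n → ℤ
vsum = foldr _ (λ x s → val x + s) (+ 0)

SmallSum : ∀ {n} → Vec PM n → Set
SmallSum v = ∣ vsum v ∣ ≤ 1

smallSum? : ∀ {n} (v : Vec PM n) → Dec (SmallSum v)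
smallSum? v = ∣ vsum v ∣ ≤? 1

Matrix : ℕ → ℕ → Set
Matrix m n = Vec (Vec PM n) m

InA : ∀ {m n} → Matrix m n → Set
InA M = All SmallSum M × All SmallSum (transpose M)

inA? : ∀ {m n} (M : Matrix m n) → Dec (InA M)
inA? M = all? smallSum? M ×-dec all? smallSum? (transpose M)

allVecs : {A : Set} → List A → (n : ℕ) → List (Vec A n)
allVecs xs zero = [ [] ]
allVecs xs (suc n) = concatMap (λ x → map (x ∷_) (allVecs xs n)) xs

allMatrices : (m n : ℕ) → List (Matrix m n)
allMatrices m n = allVecs (allVecs (plus1 ∷ minus1 ∷ []) n) m

α : ℕ → ℕ → ℕ
α m n = length (filter inA? (allMatrices m n))

ℕtoℚ : ℕ → ℚ
ℕtoℚ k = (+ k) / 1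

{-# OPTIONS --safe #-}

-- Column by column, a matrix in A(m, n) is an n-step walk from the origin whose steps are the
-- α(m, 1) admissible columns and which ends with all coordinates in {-1, 0, 1}. For even m the
-- columns have sum zero, so one coordinate is redundant; in both cases the walk is genuinely of
-- odd dimension d = 2⌊(m - 1)/2⌋ + 1.
--
-- Upper bound: for every direction i there is a pair of steps differing only in the sign of
-- coordinate i. Assign a direction to each time; whenever the step taken belongs to the pair of
-- that direction, it is a fair coin for coordinate i. Conditionally on the rest, the coordinates
-- are independent coin sums, and j coins hit a given value with probability O(1/√j). The squared
-- bounds are propagated by a weighted Cauchy–Schwarz inequality, which avoids real numbers.
--
-- Lower bound: the steps are symmetric, so the number of closed walks of length 2k is the number of
-- pairs of k-step walks with the same endpoint. By Chebyshev at least half of the k-step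
-- walks end in a box of side O(√k), and Cauchy–Schwarz over the points of this box gives enough collisions.

module Submission where

open import Defs
open import Data.Nat using (ℕ; suc; _≥_; _^_; _/_)
open import Data.Nat.Combinatorics using (_C_)
open import Data.Product using (Σ; ∃; _×_)
open import Relation.Binary.PropositionalEquality using (_≡_)

module _ where

  open import Data.Nat
  open import Data.Nat.Properties
  open import Data.Nat.DivMod using (m≡m%n+[m/n]*n; m%n<n)
  open import Data.Nat.Combinatorics using (nCk+nC[k+1]≡[n+1]C[k+1]; nCk≡nC[n∸k])
  open import Data.Nat.ListAction using (sum)
  open import Data.Nat.ListAction.Properties using (sum-++; sum-↭)
  open import Data.Nat.Tactic.RingSolver using (solve-∀)
  open import Data.Integer as ℤ using (ℤ; -[1+_]; ∣_∣; 0ℤ; 1ℤ)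
  import Data.Integer.Properties as ℤ
  open import Data.Integer.Tactic.RingSolver using () renaming (solve-∀ to ℤ-solve-∀)
  open import Data.Rational as ℚ using (ℚ; 0ℚ; fromℚᵘ)
  import Data.Rational.Properties as ℚ
  open import Data.Rational.Unnormalised as ℚᵘ using (mkℚᵘ; *≤*)
  import Data.Rational.Unnormalised.Properties as ℚᵘ
  open import Data.Fin using (Fin; zero; suc)
  open import Data.List as List using (List; []; _∷_; [_]; _++_; map; concatMap; filter; length; allFin)
  open import Data.List.Properties using (map-++; map-∘; length-++; length-map; length-replicate; length-tabulate)
  open import Data.List.Membership.Propositional using (_∈_)
  open import Data.List.Membership.Propositional.Properties using (∈-allFin; ∈-filter⁺; ∈-map⁺; ∈-concat⁺′; ∈-∃++)
  open import Data.List.Relation.Unary.Any using (here; there)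
  open import Data.List.Relation.Binary.Permutation.Propositional using (_↭_; ↭-trans; ↭-prep)
  open import Data.List.Relation.Binary.Permutation.Propositional.Properties using (map⁺; ↭-length; ∈-resp-↭) renaming (shift to ↭-shift)
  open import Data.Vec as Vec using (Vec; []; _∷_; replicate; zipWith; transpose; lookup; insertAt; updateAt; tail)
  open import Data.Vec.Properties using (insertAt-lookup)
  open import Data.Vec.Relation.Unary.All using (_∷_; all?; uncons)
  open import Data.Product using (_,_; proj₁; proj₂; ∃₂)
  open import Data.Sum using (_⊎_; inj₁; inj₂)
  open import Data.Empty using (⊥-elim)
  open import Function using (_∘_)
  open import Relation.Nullary using (¬_)
  open import Relation.Nullary.Decidable using (Dec; yes; no; _×-dec_)
  open import Relation.Binary.PropositionalEquality hiding ([_])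
  open import Algebra.Properties.CommutativeSemigroup +-commutativeSemigroup using () renaming (interchange to +-interchange)

  -- Finite sums and walks on the line

  ∑ : {A : Set} → List A → (A → ℕ) → ℕ
  ∑ xs f = sum (map f xs)

  ∑-cong : {A : Set} (xs : List A) {f g : A → ℕ} → (∀ x → f x ≡ g x) → ∑ xs f ≡ ∑ xs g
  ∑-cong []       eq = refl
  ∑-cong (x ∷ xs) eq = cong₂ _+_ (eq x) (∑-cong xs eq)

  ∑-mono : {A : Set} (xs : List A) {f g : A → ℕ} → (∀ x → f x ≤ g x) → ∑ xs f ≤ ∑ xs g
  ∑-mono []       le = z≤n
  ∑-mono (x ∷ xs) le = +-mono-≤ (le x) (∑-mono xs le)

  ∑-+ : {A : Set} (xs : List A) (f g : A → ℕ) → ∑ xs (λ x → f x + g x) ≡ ∑ xs f + ∑ xs g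
  ∑-+ []       f g = refl
  ∑-+ (x ∷ xs) f g =
    trans (cong (f x + g x +_) (∑-+ xs f g)) (+-interchange (f x) (g x) (∑ xs f) (∑ xs g))

  ∑-*ˡ : {A : Set} (xs : List A) (c : ℕ) (f : A → ℕ) → ∑ xs (λ x → c * f x) ≡ c * ∑ xs f
  ∑-*ˡ []       c f = sym (*-zeroʳ c)
  ∑-*ˡ (x ∷ xs) c f =
    trans (cong (c * f x +_) (∑-*ˡ xs c f)) (sym (*-distribˡ-+ c (f x) (∑ xs f)))

  ∑-const : {A : Set} (xs : List A) (c : ℕ) → ∑ xs (λ _ → c) ≡ length xs * c
  ∑-const []       c = refl
  ∑-const (x ∷ xs) c = cong (c +_) (∑-const xs c)

  ∑-swap : {A B : Set} (xs : List A) (ys : List B) (f : A → B → ℕ) →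
           ∑ xs (λ x → ∑ ys (f x)) ≡ ∑ ys (λ y → ∑ xs (λ x → f x y))
  ∑-swap []       ys f = sym (trans (∑-const ys 0) (*-zeroʳ (length ys)))
  ∑-swap (x ∷ xs) ys f =
    trans (cong (∑ ys (f x) +_) (∑-swap xs ys f)) (sym (∑-+ ys (f x) (λ y → ∑ xs (λ x → f x y))))

  ∑-++ : {A : Set} (xs ys : List A) (f : A → ℕ) → ∑ (xs ++ ys) f ≡ ∑ xs f + ∑ ys f
  ∑-++ xs ys f = trans (cong sum (map-++ f xs ys)) (sum-++ (map f xs) (map f ys))

  ∑-map : {A B : Set} (g : A → B) (xs : List A) (f : B → ℕ) → ∑ (map g xs) f ≡ ∑ xs (f ∘ g)
  ∑-map g xs f = cong sum (sym (map-∘ xs))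

  ∑-concatMap : {A B : Set} (g : A → List B) (xs : List A) (f : B → ℕ) →
                ∑ (concatMap g xs) f ≡ ∑ xs (λ x → ∑ (g x) f)
  ∑-concatMap g []       f = refl
  ∑-concatMap g (x ∷ xs) f =
    trans (∑-++ (g x) (concatMap g xs) f) (cong (∑ (g x) f +_) (∑-concatMap g xs f))

  ∑-↭ : {A : Set} {xs ys : List A} (f : A → ℕ) → xs ↭ ys → ∑ xs f ≡ ∑ ys f
  ∑-↭ f p = sum-↭ (map⁺ f p)

  [_]¹ : {P : Set} → Dec P → ℕ
  [ yes _ ]¹ = 1
  [ no  _ ]¹ = 0

  ∑-filter : {A : Set} {P : A → Set} (P? : (x : A) → Dec (P x)) (xs : List A) (f : A → ℕ) →
             ∑ (filter P? xs) f ≡ ∑ xs (λ x → [ P? x ]¹ * f x)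
  ∑-filter P? []       f = refl
  ∑-filter P? (x ∷ xs) f with P? x
  ... | yes _ = cong₂ _+_ (sym (+-identityʳ (f x))) (∑-filter P? xs f)
  ... | no  _ = ∑-filter P? xs f

  length-∑ : {A : Set} (xs : List A) → length xs ≡ ∑ xs (λ _ → 1)
  length-∑ xs = sym (trans (∑-const xs 1) (*-identityʳ (length xs)))

  ordered-2*m*n≤m*m+n*n : ∀ {m n} → m ≤ n → 2 * (m * n) ≤ m * m + n * n
  ordered-2*m*n≤m*m+n*n {m} m≤n with k , refl ← m≤n⇒∃[o]m+o≡n m≤n =
    ≤-trans (m≤m+n _ (k * k)) (≤-reflexive (sym (square-difference m k)))
    where
    square-difference : ∀ m k → m * m + (m + k) * (m + k) ≡ 2 * (m * (m + k)) + k * k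
    square-difference = solve-∀

  2*m*n≤m*m+n*n : ∀ m n → 2 * (m * n) ≤ m * m + n * n
  2*m*n≤m*m+n*n m n with ≤-total m n
  ... | inj₁ m≤n = ordered-2*m*n≤m*m+n*n m≤n
  ... | inj₂ n≤m = subst₂ _≤_ (cong (2 *_) (*-comm n m)) (+-comm (n * n) (m * m)) (ordered-2*m*n≤m*m+n*n n≤m)

  -- Induction on the list: the new element creates the cross term `2 * (c * t)`, and each of its
  -- summands `2 * (c * f y)` is at most `c * c + f y * f y`.
  ∑-Cauchy : {A : Set} (xs : List A) (f : A → ℕ) →
             ∑ xs f * ∑ xs f ≤ length xs * ∑ xs (λ x → f x * f x)
  ∑-Cauchy []       f = z≤n
  ∑-Cauchy (x ∷ xs) f = begin
    (c + t) * (c + t)                       ≡⟨ expand c t ⟩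
    c * c + 2 * (c * t) + t * t             ≤⟨ +-mono-≤ (+-monoʳ-≤ (c * c) cross) (∑-Cauchy xs f) ⟩
    c * c + (n * (c * c) + q) + n * q       ≡⟨ collect n (c * c) q ⟩
    (1 + n) * (c * c + q)                   ∎
    where
    open ≤-Reasoning
    c t q n : ℕ
    c = f x
    t = ∑ xs f
    q = ∑ xs (λ y → f y * f y)
    n = length xs
    expand : ∀ c t → (c + t) * (c + t) ≡ c * c + 2 * (c * t) + t * t
    expand = solve-∀
    collect : ∀ n a q → a + (n * a + q) + n * q ≡ (1 + n) * (a + q)
    collect = solve-∀
    cross : 2 * (c * t) ≤ n * (c * c) + q
    cross = begin
      2 * (c * t)                         ≡⟨ cong (2 *_) (∑-*ˡ xs c f) ⟨
      2 * ∑ xs (λ y → c * f y)            ≡⟨ ∑-*ˡ xs 2 (λ y → c * f y) ⟨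
      ∑ xs (λ y → 2 * (c * f y))          ≤⟨ ∑-mono xs (λ y → 2*m*n≤m*m+n*n c (f y)) ⟩
      ∑ xs (λ y → c * c + f y * f y)      ≡⟨ ∑-+ xs (λ _ → c * c) (λ y → f y * f y) ⟩
      ∑ xs (λ _ → c * c) + q              ≡⟨ cong (_+ q) (∑-const xs (c * c)) ⟩
      n * (c * c) + q                     ∎

  -- u j z is the number of ±1 walks of length j from z (or, by symmetry, from - z) into {-1, 0, 1}.
  u : ℕ → ℕ → ℕ
  u zero    z       = [ z ≤? 1 ]¹
  u (suc j) zero    = 2 * u j 1
  u (suc j) (suc z) = u j z + u j (2 + z)

  -- The values of `u j` are binomial coefficients, and this is the ratio of two neighbours in a
  -- row: an equality in row `j + 1` when `j + z` is odd, an inequality when it is even. The term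
  -- `z * u j z` stands on the left to avoid truncated subtraction.
  u-ratio : ∀ j z → (j + z + 3) * u j (2 + z) + z * u j z ≤ (1 + j) * u j z
  u-ratio zero zero          = z≤n
  u-ratio zero (suc zero)    = s≤s z≤n
  u-ratio zero (suc (suc z)) rewrite *-zeroʳ z | *-zeroʳ (2 + z + 3) = z≤n
  u-ratio (suc j) zero = +-cancelʳ-≤ b _ _ (begin
    (1 + j + 0 + 3) * (b + c) + 0 + b          ≡⟨ e₁ j b c ⟩
    (j + 4) * b + ((j + 1 + 3) * c + 1 * b)    ≤⟨ +-monoʳ-≤ ((j + 4) * b) (u-ratio j 1) ⟩
    (j + 4) * b + (1 + j) * b                  ≡⟨ e₂ j b ⟩
    (1 + (1 + j)) * (2 * b) + b                ∎)
    where
    open ≤-Reasoning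
    b c : ℕ
    b = u j 1
    c = u j 3
    e₁ : ∀ j b c → (1 + j + 0 + 3) * (b + c) + 0 + b ≡ (j + 4) * b + ((j + 1 + 3) * c + 1 * b)
    e₁ = solve-∀
    e₂ : ∀ j b → (j + 4) * b + (1 + j) * b ≡ (1 + (1 + j)) * (2 * b) + b
    e₂ = solve-∀
  -- The same quantity is added to both sides, so that the left side contains the left sides of the
  -- induction hypotheses at `2 + z` and at `z`.
  u-ratio (suc j) (suc z) = +-cancelʳ-≤ ((2 + z) * b + (j + z + 3) * b + z * a) _ _ (begin
    (1 + j + (1 + z) + 3) * (b + c) + (1 + z) * (a + b) + ((2 + z) * b + (j + z + 3) * b + z * a)
      ≡⟨ e₁ j z a b c ⟩
    ((j + (2 + z) + 3) * c + (2 + z) * b) + ((j + z + 3) * b + z * a) + ((j + z + 5) * b + (1 + z) * (a + b))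
      ≤⟨ +-monoˡ-≤ _ (+-mono-≤ (u-ratio j (2 + z)) (u-ratio j z)) ⟩
    (1 + j) * b + (1 + j) * a + ((j + z + 5) * b + (1 + z) * (a + b))
      ≡⟨ e₂ j z a b ⟩
    (1 + (1 + j)) * (a + b) + ((2 + z) * b + (j + z + 3) * b + z * a) ∎)
    where
    open ≤-Reasoning
    a b c : ℕ
    a = u j z
    b = u j (2 + z)
    c = u j (4 + z)
    e₁ : ∀ j z a b c →
      (1 + j + (1 + z) + 3) * (b + c) + (1 + z) * (a + b) + ((2 + z) * b + (j + z + 3) * b + z * a) ≡
      ((j + (2 + z) + 3) * c + (2 + z) * b) + ((j + z + 3) * b + z * a) + ((j + z + 5) * b + (1 + z) * (a + b))
    e₁ = solve-∀
    e₂ : ∀ j z a b →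
      (1 + j) * b + (1 + j) * a + ((j + z + 5) * b + (1 + z) * (a + b)) ≡
      (1 + (1 + j)) * (a + b) + ((2 + z) * b + (j + z + 3) * b + z * a)
    e₂ = solve-∀

  u-antitone : ∀ j z → u j (2 + z) ≤ u j z
  u-antitone zero          z             = z≤n
  u-antitone (suc j) zero    = begin
    u j 1 + u j 3       ≤⟨ +-monoʳ-≤ (u j 1) (u-antitone j 1) ⟩
    u j 1 + u j 1       ≡⟨ cong (u j 1 +_) (+-identityʳ (u j 1)) ⟨
    2 * u j 1           ∎
    where open ≤-Reasoning
  u-antitone (suc j) (suc z) = +-mono-≤ (u-antitone j z) (u-antitone j (2 + z))

  -- Along each parity class `u j` decreases, so its maximum is attained at 0 or at 1.
  peak : ℕ → ℕ
  peak j = u j 0 ⊔ u j 1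

  u-max : ∀ j z → u j z ≤ peak j
  u-max j zero          = m≤m⊔n _ _
  u-max j (suc zero)    = m≤n⊔m (u j 0) _
  u-max j (suc (suc z)) = ≤-trans (u-antitone j z) (u-max j z)

  -- The squared form of a bound of order 2^j / √j. Induction in steps of two: at `z = 0`, `u-ratio`
  -- bounds the growth factor by `4 * (j + 2) / (j + 3)`. The constant 3 makes the case `j = 1` an
  -- equality.
  u-central : ∀ j → u j 0 * u j 0 * (2 + j) ≤ 3 * 4 ^ j
  u-central zero          = s≤s (s≤s z≤n)
  u-central (suc zero)    = ≤-refl
  u-central (suc (suc j)) = *-cancelˡ-≤ ((j + 3) * (j + 3)) {{m*n≢0 (j + 3) (j + 3) {{j+3≢0}} {{j+3≢0}}}} (begin
    (j + 3) * (j + 3) * (V * V * (4 + j))           ≡⟨ e₁ j V ⟩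
    (j + 3) * V * ((j + 3) * V) * (4 + j)           ≤⟨ *-monoˡ-≤ (4 + j) (*-mono-≤ step step) ⟩
    -- The added term completes `(j + 2) * (j + 4)` to the square of `j + 3`.
    4 * (j + 2) * c * (4 * (j + 2) * c) * (4 + j)   ≤⟨ m≤m+n _ (16 * (j + 2) * (c * c)) ⟩
    4 * (j + 2) * c * (4 * (j + 2) * c) * (4 + j) + 16 * (j + 2) * (c * c)
                                                    ≡⟨ e₂ j c ⟩
    (j + 3) * (j + 3) * (16 * (c * c * (2 + j)))    ≤⟨ *-monoʳ-≤ ((j + 3) * (j + 3)) (*-monoʳ-≤ 16 (u-central j)) ⟩
    (j + 3) * (j + 3) * (16 * (3 * 4 ^ j))          ≡⟨ cong ((j + 3) * (j + 3) *_) (e₃ (4 ^ j)) ⟩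
    (j + 3) * (j + 3) * (3 * (4 * (4 * 4 ^ j)))     ∎)
    where
    open ≤-Reasoning
    c V : ℕ
    c = u j 0
    V = u (2 + j) 0
    j+3≢0 : NonZero (j + 3)
    j+3≢0 = >-nonZero (≤-trans (s≤s z≤n) (m≤n+m 3 j))
    e₁ : ∀ j V → (j + 3) * (j + 3) * (V * V * (4 + j)) ≡ (j + 3) * V * ((j + 3) * V) * (4 + j)
    e₁ = solve-∀
    e₂ : ∀ j c → 4 * (j + 2) * c * (4 * (j + 2) * c) * (4 + j) + 16 * (j + 2) * (c * c) ≡
                 (j + 3) * (j + 3) * (16 * (c * c * (2 + j)))
    e₂ = solve-∀
    e₃ : ∀ p → 16 * (3 * p) ≡ 3 * (4 * (4 * p))
    e₃ = solve-∀
    e₄ : ∀ j c w → (j + 3) * (2 * (c + w)) ≡ 2 * ((j + 0 + 3) * w + 0) + 2 * (j + 3) * c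
    e₄ = solve-∀
    e₅ : ∀ j c → 2 * ((1 + j) * c) + 2 * (j + 3) * c ≡ 4 * (j + 2) * c
    e₅ = solve-∀
    step : (j + 3) * V ≤ 4 * (j + 2) * c
    step = begin
      (j + 3) * (2 * (c + u j 2))                          ≡⟨ e₄ j c (u j 2) ⟩
      2 * ((j + 0 + 3) * u j 2 + 0) + 2 * (j + 3) * c      ≤⟨ +-monoˡ-≤ _ (*-monoʳ-≤ 2 (u-ratio j 0)) ⟩
      2 * ((1 + j) * c) + 2 * (j + 3) * c                  ≡⟨ e₅ j c ⟩
      4 * (j + 2) * c                                      ∎

  peak-bound : ∀ j → peak j * peak j * (1 + j) ≤ 3 * 4 ^ j
  peak-bound j with ⊔-sel (u j 0) (u j 1)
  ... | inj₁ eq rewrite eq = ≤-trans (*-monoʳ-≤ (u j 0 * u j 0) (n≤1+n (1 + j))) (u-central j)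
  -- Since `2 * u j 1` is `u (suc j) 0`, this case reduces to the central value of the next row.
  ... | inj₂ eq rewrite eq = *-cancelˡ-≤ 4 (begin
    4 * (u j 1 * u j 1 * (1 + j))             ≡⟨ e (u j 1) (1 + j) ⟩
    2 * u j 1 * (2 * u j 1) * (1 + j)         ≤⟨ *-monoʳ-≤ (2 * u j 1 * (2 * u j 1)) (m≤n+m (1 + j) 2) ⟩
    2 * u j 1 * (2 * u j 1) * (3 + j)         ≤⟨ u-central (suc j) ⟩
    3 * (4 * 4 ^ j)                           ≡⟨ e′ (4 ^ j) ⟩
    4 * (3 * 4 ^ j)                           ∎)
    where
    open ≤-Reasoning
    e : ∀ a b → 4 * (a * a * b) ≡ 2 * a * (2 * a) * b
    e = solve-∀
    e′ : ∀ p → 3 * (4 * p) ≡ 4 * (3 * p)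
    e′ = solve-∀

  -- The two parity classes of z are covered by s = 0 and s = 1.
  u-binomial : ∀ s → s ≤ 1 → ∀ j z q → s + j + z ≡ 2 * q → u j z ≡ (s + j) C q
  u-binomial zero _ zero z q refl = base q
    where
    base : ∀ q → u 0 (2 * q) ≡ 0 C q
    base zero    = refl
    base (suc q) rewrite +-suc q (q + 0) = refl
  u-binomial (suc zero) _ zero z (suc q) eq = base q z (trans (suc-injective eq) (+-suc q (q + 0)))
    where
    base : ∀ q z → z ≡ suc (q + (q + 0)) → u 0 z ≡ 1 C suc q
    base zero    z refl = refl
    base (suc q) z refl = refl
  u-binomial (suc zero) _ zero z zero ()
  u-binomial (suc (suc s)) (s≤s ()) zero
  u-binomial s s≤1 (suc j) zero zero eq with () ← trans (sym (trans (+-identityʳ (s + suc j)) (+-suc s j))) eq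
  u-binomial s s≤1 (suc j) zero (suc q) eq = begin
    2 * u j 1                                    ≡⟨ cong (u j 1 +_) (+-identityʳ (u j 1)) ⟩
    u j 1 + u j 1                                ≡⟨ cong₂ _+_ (u-binomial s s≤1 j 1 (suc q) (trans (+-comm (s + j) 1) eq′)) (u-binomial s s≤1 j 1 (suc q) (trans (+-comm (s + j) 1) eq′)) ⟩
    (s + j) C suc q + (s + j) C suc q            ≡⟨ cong (_+ (s + j) C suc q) symm ⟨
    (s + j) C q + (s + j) C suc q                ≡⟨ nCk+nC[k+1]≡[n+1]C[k+1] (s + j) q ⟩
    suc (s + j) C suc q                          ≡⟨ cong (_C suc q) (+-suc s j) ⟨
    (s + suc j) C suc q                          ∎
    where
    open ≡-Reasoning
    eq′ : 1 + (s + j) ≡ 2 * suc q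
    eq′ = trans (sym (trans (+-identityʳ (s + suc j)) (+-suc s j))) eq
    s+j : s + j ≡ q + suc q
    s+j = trans (suc-injective eq′) (cong (λ r → q + suc r) (+-identityʳ q))
    -- From 0 both neighbours contribute the same coefficient; as `s + j` is `2 * q + 1`, the
    -- symmetry of the row turns one copy into the other term of Pascal's rule.
    symm : (s + j) C q ≡ (s + j) C suc q
    symm rewrite s+j = trans (nCk≡nC[n∸k] (m≤m+n q (suc q))) (cong ((q + suc q) C_) (m+n∸m≡n q (suc q)))
  u-binomial s s≤1 (suc j) (suc z) zero eq with () ← trans (sym (+-suc (s + suc j) z)) eq
  u-binomial s s≤1 (suc j) (suc z) (suc q) eq = begin
    u j z + u j (2 + z)                          ≡⟨ cong₂ _+_ (u-binomial s s≤1 j z q eq₁) (u-binomial s s≤1 j (2 + z) (suc q) eq₂) ⟩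
    (s + j) C q + (s + j) C suc q                ≡⟨ nCk+nC[k+1]≡[n+1]C[k+1] (s + j) q ⟩
    suc (s + j) C suc q                          ≡⟨ cong (_C suc q) (+-suc s j) ⟨
    (s + suc j) C suc q                          ∎
    where
    open ≡-Reasoning
    shift : ∀ s j z → s + suc j + suc z ≡ 2 + (s + j + z)
    shift = solve-∀
    shift′ : ∀ s j z → s + suc j + suc z ≡ s + j + (2 + z)
    shift′ = solve-∀
    double : ∀ q → 2 * suc q ≡ 2 + 2 * q
    double = solve-∀
    eq₁ : s + j + z ≡ 2 * q
    eq₁ = suc-injective (suc-injective (trans (sym (shift s j z)) (trans eq (double q))))
    eq₂ : s + j + (2 + z) ≡ 2 * suc q
    eq₂ = trans (sym (shift′ s j z)) eq

  -- Matrices as walks of columns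

  []¹-⇔ : {P Q : Set} → (P → Q) → (Q → P) → (p : Dec P) (q : Dec Q) → [ p ]¹ ≡ [ q ]¹
  []¹-⇔ f g (yes _) (yes _) = refl
  []¹-⇔ f g (yes p) (no ¬q) = ⊥-elim (¬q (f p))
  []¹-⇔ f g (no ¬p) (yes q) = ⊥-elim (¬p (g q))
  []¹-⇔ f g (no _)  (no _)  = refl

  []¹-× : {P Q : Set} (p : Dec P) (q : Dec Q) → [ p ×-dec q ]¹ ≡ [ p ]¹ * [ q ]¹
  []¹-× (yes _) (yes _) = refl
  []¹-× (yes _) (no _)  = refl
  []¹-× (no _)  (yes _) = refl
  []¹-× (no _)  (no _)  = refl

  []¹-all? : {A : Set} {P : A → Set} (P? : ∀ x → Dec (P x)) {n : ℕ} (x : A) (xs : Vec A n) →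
             [ all? P? (x ∷ xs) ]¹ ≡ [ P? x ]¹ * [ all? P? xs ]¹
  []¹-all? P? x xs =
    trans ([]¹-⇔ uncons (λ (p , ps) → p ∷ ps) (all? P? (x ∷ xs)) (P? x ×-dec all? P? xs))
          ([]¹-× (P? x) (all? P? xs))

  length-filter-∑ : {A : Set} {P : A → Set} (P? : ∀ x → Dec (P x)) (xs : List A) →
                    length (filter P? xs) ≡ ∑ xs (λ x → [ P? x ]¹)
  length-filter-∑ P? xs = begin
    length (filter P? xs)             ≡⟨ length-∑ (filter P? xs) ⟩
    ∑ (filter P? xs) (λ _ → 1)        ≡⟨ ∑-filter P? xs (λ _ → 1) ⟩
    ∑ xs (λ x → [ P? x ]¹ * 1)        ≡⟨ ∑-cong xs (λ x → *-identityʳ [ P? x ]¹) ⟩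
    ∑ xs (λ x → [ P? x ]¹)            ∎
    where open ≡-Reasoning

  ∑-allVecs : {A : Set} (xs : List A) (n : ℕ) (f : Vec A (suc n) → ℕ) →
              ∑ (allVecs xs (suc n)) f ≡ ∑ xs (λ x → ∑ (allVecs xs n) (λ v → f (x ∷ v)))
  ∑-allVecs xs n f =
    trans (∑-concatMap (λ x → map (x ∷_) (allVecs xs n)) xs f)
          (∑-cong xs (λ x → ∑-map (x ∷_) (allVecs xs n) f))

  ∑-allVecs-singleton : {A : Set} (a : A) (n : ℕ) (f : Vec A n → ℕ) →
                        ∑ (allVecs [ a ] n) f ≡ f (replicate n a)
  ∑-allVecs-singleton a zero    f = +-identityʳ (f [])
  ∑-allVecs-singleton a (suc n) f =
    trans (∑-allVecs [ a ] n f)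
          (trans (+-identityʳ _) (∑-allVecs-singleton a n (λ v → f (a ∷ v))))

  signs : List PM
  signs = plus1 ∷ minus1 ∷ []

  -- Matrices are enumerated by rows, walks by columns. Induction on the rows splits off the first
  -- entry of each row, and `∑-swap` moves the choice of the remaining column past the rest of the
  -- row.
  ∑-columns : ∀ m n (f : Matrix m (suc n) → ℕ) →
              ∑ (allMatrices m (suc n)) f ≡
              ∑ (allVecs signs m) (λ c → ∑ (allMatrices m n) (λ M → f (zipWith _∷_ c M)))
  ∑-columns zero    n f = sym (+-identityʳ _)
  ∑-columns (suc m) n f = begin
    ∑ (allMatrices (suc m) (suc n)) f
      ≡⟨ ∑-allVecs (allVecs signs (suc n)) m f ⟩
    ∑ (allVecs signs (suc n)) (λ r → ∑ (allMatrices m (suc n)) (λ M → f (r ∷ M)))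
      ≡⟨ ∑-cong (allVecs signs (suc n)) (λ r → ∑-columns m n (λ M → f (r ∷ M))) ⟩
    ∑ (allVecs signs (suc n)) (λ r → ∑ Cs (λ c → ∑ Ms (λ M → f (r ∷ zipWith _∷_ c M))))
      ≡⟨ ∑-allVecs signs n _ ⟩
    ∑ signs (λ p → ∑ Rs (λ r → ∑ Cs (λ c → ∑ Ms (λ M → f ((p ∷ r) ∷ zipWith _∷_ c M)))))
      ≡⟨ ∑-cong signs (λ p → ∑-swap Rs Cs (λ r c → ∑ Ms (λ M → f ((p ∷ r) ∷ zipWith _∷_ c M)))) ⟩
    ∑ signs (λ p → ∑ Cs (λ c → ∑ Rs (λ r → ∑ Ms (λ M → f ((p ∷ r) ∷ zipWith _∷_ c M)))))
      ≡⟨ ∑-cong signs (λ p → ∑-cong Cs (λ c → ∑-allVecs Rs m (λ M → f (zipWith _∷_ (p ∷ c) M)))) ⟨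
    ∑ signs (λ p → ∑ Cs (λ c → ∑ (allMatrices (suc m) n) (λ M → f (zipWith _∷_ (p ∷ c) M))))
      ≡⟨ ∑-allVecs signs m _ ⟨
    ∑ (allVecs signs (suc m)) (λ c → ∑ (allMatrices (suc m) n) (λ M → f (zipWith _∷_ c M))) ∎
    where
    open ≡-Reasoning
    Rs : List (Vec PM n)
    Rs = allVecs signs n
    Cs : List (Vec PM m)
    Cs = allVecs signs m
    Ms : List (Matrix m n)
    Ms = allMatrices m n

  transpose-∷ : ∀ {m n} (c : Vec PM m) (M : Matrix m n) → transpose (zipWith _∷_ c M) ≡ c ∷ transpose M
  transpose-∷ []      []      = refl
  transpose-∷ (p ∷ c) (r ∷ M) rewrite transpose-∷ c M = refl

  infixl 6 _⊕_
  _⊕_ : ∀ {d} → Vec ℤ d → Vec PM d → Vec ℤ d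
  _⊕_ = zipWith (λ z p → z ℤ.+ val p)

  -- The total of `f` over the endpoints of all `n`-step walks from `x`: a count if `f` is an
  -- indicator, otherwise an expectation multiplied by `length S ^ n`.
  walks : ∀ {d} → List (Vec PM d) → (Vec ℤ d → ℕ) → ℕ → Vec ℤ d → ℕ
  walks S f zero    x = f x
  walks S f (suc n) x = ∑ S (λ v → walks S f n (x ⊕ v))

  origin : ∀ {d} → Vec ℤ d
  origin = replicate _ 0ℤ

  -- The number of outcomes of independent fair coins, `j` of them in each coordinate, that move `x`
  -- to a point with all coordinates in -1, 0, 1.
  coins : ∀ {d} → Vec ℕ d → Vec ℤ d → ℕ
  coins []       []      = 1
  coins (j ∷ js) (z ∷ x) = u j ∣ z ∣ * coins js x

  small : ∀ {d} → Vec ℤ d → ℕ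
  small = coins (replicate _ 0)

  columns : (m : ℕ) → List (Vec PM m)
  columns m = filter smallSum? (allVecs signs m)

  rowSums : ∀ {m n} → Vec ℤ m → Matrix m n → Vec ℤ m
  rowSums = zipWith (λ z r → z ℤ.+ vsum r)

  rowSums-[] : ∀ {m} (x : Vec ℤ m) → rowSums x (replicate m []) ≡ x
  rowSums-[] []      = refl
  rowSums-[] (z ∷ x) = cong₂ _∷_ (ℤ.+-identityʳ z) (rowSums-[] x)

  rowSums-∷ : ∀ {m n} (x : Vec ℤ m) (c : Vec PM m) (M : Matrix m n) →
              rowSums x (zipWith _∷_ c M) ≡ rowSums (x ⊕ c) M
  rowSums-∷ []      []      []      = refl
  rowSums-∷ (z ∷ x) (p ∷ c) (r ∷ M) =
    cong₂ _∷_ (sym (ℤ.+-assoc z (val p) (vsum r))) (rowSums-∷ x c M)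

  small-rowSums : ∀ {m n} (M : Matrix m n) → [ all? smallSum? M ]¹ ≡ small (rowSums origin M)
  small-rowSums []      = refl
  small-rowSums (r ∷ M) =
    trans ([]¹-all? smallSum? r M)
          (cong₂ _*_ (cong (λ z → u 0 ∣ z ∣) (sym (ℤ.+-identityˡ (vsum r)))) (small-rowSums M))

  -- The first column of a matrix is the first step of the walk. The start `x` is arbitrary because
  -- the induction on `n` adds the columns already read to it.
  ∑-matrices : ∀ m n (x : Vec ℤ m) →
               ∑ (allMatrices m n) (λ M → small (rowSums x M) * [ all? smallSum? (transpose M) ]¹) ≡
               walks (columns m) small n x
  ∑-matrices m zero    x =
    trans (∑-allVecs-singleton [] m _)
          (trans (cong₂ _*_ (cong small (rowSums-[] x)) (all-[] (transpose (replicate m []))))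
                 (*-identityʳ (small x)))
    where
    all-[] : (t : Vec (Vec PM m) 0) → [ all? smallSum? t ]¹ ≡ 1
    all-[] [] = refl
  ∑-matrices m (suc n) x = begin
    ∑ (allMatrices m (suc n)) (λ M → small (rowSums x M) * [ all? smallSum? (transpose M) ]¹)
      ≡⟨ ∑-columns m n _ ⟩
    ∑ (allVecs signs m) (λ c → ∑ (allMatrices m n) (λ M →
      small (rowSums x (zipWith _∷_ c M)) * [ all? smallSum? (transpose (zipWith _∷_ c M)) ]¹))
      ≡⟨ ∑-cong (allVecs signs m) (λ c → ∑-cong (allMatrices m n) (λ M → prepend c M)) ⟩
    ∑ (allVecs signs m) (λ c → ∑ (allMatrices m n) (λ M →
      [ smallSum? c ]¹ * (small (rowSums (x ⊕ c) M) * [ all? smallSum? (transpose M) ]¹)))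
      ≡⟨ ∑-cong (allVecs signs m) (λ c → trans (∑-*ˡ (allMatrices m n) [ smallSum? c ]¹ _)
                                                (cong ([ smallSum? c ]¹ *_) (∑-matrices m n (x ⊕ c)))) ⟩
    ∑ (allVecs signs m) (λ c → [ smallSum? c ]¹ * walks (columns m) small n (x ⊕ c))
      ≡⟨ ∑-filter smallSum? (allVecs signs m) _ ⟨
    walks (columns m) small (suc n) x ∎
    where
    open ≡-Reasoning
    rearrange : ∀ a b c → a * (b * c) ≡ b * (a * c)
    rearrange = solve-∀
    prepend : ∀ c M →
      small (rowSums x (zipWith _∷_ c M)) * [ all? smallSum? (transpose (zipWith _∷_ c M)) ]¹ ≡
      [ smallSum? c ]¹ * (small (rowSums (x ⊕ c) M) * [ all? smallSum? (transpose M) ]¹)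
    prepend c M rewrite transpose-∷ c M | rowSums-∷ x c M =
      trans (cong (small (rowSums (x ⊕ c) M) *_) ([]¹-all? smallSum? c (transpose M)))
            (rearrange (small (rowSums (x ⊕ c) M)) [ smallSum? c ]¹ [ all? smallSum? (transpose M) ]¹)

  α-walks : ∀ m n → α m n ≡ walks (columns m) small n origin
  α-walks m n = begin
    α m n
      ≡⟨ length-filter-∑ inA? (allMatrices m n) ⟩
    ∑ (allMatrices m n) (λ M → [ inA? M ]¹)
      ≡⟨ ∑-cong (allMatrices m n) (λ M → trans ([]¹-× (all? smallSum? M) (all? smallSum? (transpose M)))
           (cong (_* [ all? smallSum? (transpose M) ]¹) (small-rowSums M))) ⟩
    ∑ (allMatrices m n) (λ M → small (rowSums origin M) * [ all? smallSum? (transpose M) ]¹)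
      ≡⟨ ∑-matrices m n origin ⟩
    walks (columns m) small n origin ∎
    where open ≡-Reasoning

  small-step : ∀ {d} (v : Vec PM d) → small (origin ⊕ v) ≡ 1
  small-step []           = refl
  small-step (plus1 ∷ v)  = trans (+-identityʳ _) (small-step v)
  small-step (minus1 ∷ v) = trans (+-identityʳ _) (small-step v)

  -- After one step from the origin all coordinates are 1 or -1, so the condition on the row sums is
  -- automatic.
  α-one : ∀ m → α m 1 ≡ length (columns m)
  α-one m = begin
    α m 1                                             ≡⟨ α-walks m 1 ⟩
    ∑ (columns m) (λ v → small (origin ⊕ v))          ≡⟨ ∑-cong (columns m) small-step ⟩
    ∑ (columns m) (λ _ → 1)                           ≡⟨ length-∑ (columns m) ⟨
    length (columns m)                                ∎
    where open ≡-Reasoning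

  u-step : ∀ j z → u (suc j) ∣ z ∣ ≡ u j ∣ z ℤ.+ val plus1 ∣ + u j ∣ z ℤ.+ val minus1 ∣
  u-step j (ℤ.+ zero)       = cong (u j 1 +_) (+-identityʳ (u j 1))
  u-step j (ℤ.+ suc n)      rewrite +-comm n 1 = +-comm (u j n) (u j (2 + n))
  u-step j -[1+ zero ]    = refl
  u-step j -[1+ suc n ]   rewrite +-identityʳ n = refl

  -- The entries of a column are themselves the steps of a walk on the line, here started at `z`.
  ∑-signs : ∀ m (z : ℤ) → ∑ (allVecs signs m) (λ v → u 0 ∣ z ℤ.+ vsum v ∣) ≡ u m ∣ z ∣
  ∑-signs zero    z = trans (+-identityʳ _) (cong (λ y → u 0 ∣ y ∣) (ℤ.+-identityʳ z))
  ∑-signs (suc m) z = begin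
    ∑ (allVecs signs (suc m)) (λ v → u 0 ∣ z ℤ.+ vsum v ∣)
      ≡⟨ ∑-allVecs signs m _ ⟩
    ∑ signs (λ p → ∑ (allVecs signs m) (λ v → u 0 ∣ z ℤ.+ (val p ℤ.+ vsum v) ∣))
      ≡⟨ ∑-cong signs (λ p → ∑-cong (allVecs signs m) (λ v → cong (λ y → u 0 ∣ y ∣) (sym (ℤ.+-assoc z (val p) (vsum v))))) ⟩
    ∑ signs (λ p → ∑ (allVecs signs m) (λ v → u 0 ∣ z ℤ.+ val p ℤ.+ vsum v ∣))
      ≡⟨ ∑-cong signs (λ p → ∑-signs m (z ℤ.+ val p)) ⟩
    u m ∣ z ℤ.+ val plus1 ∣ + (u m ∣ z ℤ.+ val minus1 ∣ + 0)
      ≡⟨ cong (u m ∣ z ℤ.+ val plus1 ∣ +_) (+-identityʳ _) ⟩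
    u m ∣ z ℤ.+ val plus1 ∣ + u m ∣ z ℤ.+ val minus1 ∣
      ≡⟨ u-step m z ⟨
    u (suc m) ∣ z ∣ ∎
    where open ≡-Reasoning

  length-columns : ∀ m → length (columns m) ≡ u m 0
  length-columns m = begin
    length (columns m)                                          ≡⟨ length-filter-∑ smallSum? (allVecs signs m) ⟩
    ∑ (allVecs signs m) (λ v → u 0 ∣ vsum v ∣)                  ≡⟨ ∑-cong (allVecs signs m) (λ v → cong (λ y → u 0 ∣ y ∣) (sym (ℤ.+-identityˡ (vsum v)))) ⟩
    ∑ (allVecs signs m) (λ v → u 0 ∣ 0ℤ ℤ.+ vsum v ∣)           ≡⟨ ∑-signs m 0ℤ ⟩
    u m 0                                                       ∎
    where open ≡-Reasoning

  -- Upper bound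

  -- Stated with a permutation so that the pair of steps differing only in coordinate `i` splits off
  -- from any sum over `S`, with the multiplicities of the list respected.
  Flippable : ∀ {d} → List (Vec PM (suc d)) → Set
  Flippable {d} S = ∀ i → ∃₂ λ (w : Vec PM d) rest → S ↭ insertAt w i plus1 ∷ insertAt w i minus1 ∷ rest

  shift : ∀ {d} → Fin d → PM → Vec ℤ d → Vec ℤ d
  shift i p x = updateAt x i (ℤ._+ val p)

  ⊕-insertAt : ∀ {d} (x : Vec ℤ (suc d)) (w : Vec PM d) i →
               ∃ λ y → ∀ p → x ⊕ insertAt w i p ≡ shift i p y
  ⊕-insertAt (z ∷ x) w       zero    = z ∷ (x ⊕ w) , λ p → refl
  ⊕-insertAt (z ∷ x) (q ∷ w) (suc i) with y , eq ← ⊕-insertAt x w i =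
    (z ℤ.+ val q) ∷ y , λ p → cong (z ℤ.+ val q ∷_) (eq p)

  shift-⊕ : ∀ {d} i p (x : Vec ℤ d) v → shift i p x ⊕ v ≡ shift i p (x ⊕ v)
  shift-⊕ zero    p (z ∷ x) (q ∷ v) = cong (_∷ (x ⊕ v)) (begin
    z ℤ.+ val p ℤ.+ val q     ≡⟨ ℤ.+-assoc z (val p) (val q) ⟩
    z ℤ.+ (val p ℤ.+ val q)   ≡⟨ cong (λ y → z ℤ.+ y) (ℤ.+-comm (val p) (val q)) ⟩
    z ℤ.+ (val q ℤ.+ val p)   ≡⟨ ℤ.+-assoc z (val q) (val p) ⟨
    z ℤ.+ val q ℤ.+ val p     ∎)
    where open ≡-Reasoning
  shift-⊕ (suc i) p (z ∷ x) (q ∷ v) = cong (z ℤ.+ val q ∷_) (shift-⊕ i p x v)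

  bump : ∀ {d} → Fin d → Vec ℕ d → Vec ℕ d
  bump i j = updateAt j i suc

  coins-bump : ∀ {d} i (j : Vec ℕ d) x →
               coins (bump i j) x ≡ coins j (shift i plus1 x) + coins j (shift i minus1 x)
  coins-bump zero    (j ∷ js) (z ∷ x) =
    trans (cong (_* coins js x) (u-step j z)) (*-distribʳ-+ (coins js x) (u j ∣ z ℤ.+ val plus1 ∣) _)
  coins-bump (suc i) (j ∷ js) (z ∷ x) =
    trans (cong (u j ∣ z ∣ *_) (coins-bump i js x)) (*-distribˡ-+ (u j ∣ z ∣) _ _)

  -- Steps commute, so a coin tossed at the end of the walk may as well displace its start.
  walks-bump : ∀ {d} S i (j : Vec ℕ d) n x →
               walks S (coins (bump i j)) n x ≡
               walks S (coins j) n (shift i plus1 x) + walks S (coins j) n (shift i minus1 x)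
  walks-bump S i j zero    x = coins-bump i j x
  walks-bump S i j (suc n) x = begin
    ∑ S (λ v → walks S (coins (bump i j)) n (x ⊕ v))
      ≡⟨ ∑-cong S (λ v → trans (walks-bump S i j n (x ⊕ v))
           (cong₂ (λ y y′ → walks S (coins j) n y + walks S (coins j) n y′)
             (sym (shift-⊕ i plus1 x v)) (sym (shift-⊕ i minus1 x v)))) ⟩
    ∑ S (λ v → walks S (coins j) n (shift i plus1 x ⊕ v) + walks S (coins j) n (shift i minus1 x ⊕ v))
      ≡⟨ ∑-+ S _ _ ⟩
    walks S (coins j) (suc n) (shift i plus1 x) + walks S (coins j) (suc n) (shift i minus1 x) ∎
    where open ≡-Reasoning

  peaks : ∀ {d} → Vec ℕ d → ℕ
  peaks []       = 1
  peaks (j ∷ js) = peak j * peaks js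

  coins≤peaks : ∀ {d} (j : Vec ℕ d) x → coins j x ≤ peaks j
  coins≤peaks []       []      = ≤-refl
  coins≤peaks (j ∷ js) (z ∷ x) = *-mono-≤ (u-max j ∣ z ∣) (coins≤peaks js x)

  -- Bound on the number of walks when the successive steps are examined along the directions L:
  -- the flippable pair of steps yields a fair coin in that direction, the other a steps are fixed.
  majorant : ∀ {d} → ℕ → List (Fin d) → Vec ℕ d → ℕ
  majorant a []      j = peaks j
  majorant a (i ∷ L) j = a * majorant a L j + majorant a L (bump i j)

  -- The two steps of the flippable pair together amount to one more coin in direction `i`, by
  -- `walks-bump`; the other `a` steps are bounded one by one. When `L` is exhausted only the coins
  -- are left, and their count is at most the product of the peaks.
  walks≤majorant : ∀ {d} (S : List (Vec PM (suc d))) → Flippable S → ∀ {a} → length S ≡ 2 + a →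
                   ∀ L j x → walks S (coins j) (length L) x ≤ majorant a L j
  walks≤majorant S flip len []      j x = coins≤peaks j x
  walks≤majorant S flip {a} len (i ∷ L) j x with flip i
  ... | w , rest , S↭ with ⊕-insertAt x w i
  ... | y , eq = begin
    ∑ S N
      ≡⟨ ∑-↭ N S↭ ⟩
    N (insertAt w i plus1) + (N (insertAt w i minus1) + ∑ rest N)
      ≡⟨ +-assoc (N (insertAt w i plus1)) _ _ ⟨
    N (insertAt w i plus1) + N (insertAt w i minus1) + ∑ rest N
      ≡⟨ cong₂ (λ y y′ → walks S (coins j) (length L) y + walks S (coins j) (length L) y′ + ∑ rest N) (eq plus1) (eq minus1) ⟩
    walks S (coins j) (length L) (shift i plus1 y) + walks S (coins j) (length L) (shift i minus1 y) + ∑ rest N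
      ≡⟨ cong (_+ ∑ rest N) (walks-bump S i j (length L) y) ⟨
    walks S (coins (bump i j)) (length L) y + ∑ rest N
      ≤⟨ +-mono-≤ (walks≤majorant S flip len L (bump i j) y) (∑-mono rest (λ v → walks≤majorant S flip len L j (x ⊕ v))) ⟩
    majorant a L (bump i j) + ∑ rest (λ _ → majorant a L j)
      ≡⟨ cong (majorant a L (bump i j) +_) (trans (∑-const rest _) (cong (_* majorant a L j) len-rest)) ⟩
    majorant a L (bump i j) + a * majorant a L j
      ≡⟨ +-comm (majorant a L (bump i j)) _ ⟩
    a * majorant a L j + majorant a L (bump i j) ∎
    where
    open ≤-Reasoning
    N : Vec PM _ → ℕ
    N v = walks S (coins j) (length L) (x ⊕ v)
    len-rest : length rest ≡ a
    len-rest = suc-injective (suc-injective (trans (sym (↭-length S↭)) len))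

  -- The denominator of the squared bound. In each direction a tossed coin adds `K` to the factor
  -- and an examination still to come adds 1; the constant term `K` keeps the factor at least `K`.
  weight : ∀ {d} → ℕ → Vec ℕ d → Vec ℕ d → ℕ
  weight K []       []       = 1
  weight K (j ∷ js) (c ∷ cs) = (K * (1 + j) + c) * weight K js cs

  -- `Y` is the factor of direction `i` and `R` the product of the other factors.
  weight-split : ∀ {d} K i (j c : Vec ℕ d) → ∃₂ λ Y R → K ≤ Y ×
                 weight K j c ≡ Y * R × weight K (bump i j) c ≡ (Y + K) * R × weight K j (bump i c) ≡ (1 + Y) * R
  weight-split K zero (j ∷ js) (c ∷ cs) =
    K * (1 + j) + c , weight K js cs , ≤-trans (m≤m*n K (1 + j)) (m≤m+n _ c) , refl ,
    cong (_* weight K js cs) (e K j c) , cong (_* weight K js cs) (+-suc (K * (1 + j)) c)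
    where
    e : ∀ K j c → K * (1 + suc j) + c ≡ K * (1 + j) + c + K
    e = solve-∀
  weight-split K (suc i) (j ∷ js) (c ∷ cs) with Y , R , K≤Y , e₁ , e₂ , e₃ ← weight-split K i js cs =
    Y , F * R , K≤Y , pull Y e₁ , pull (Y + K) e₂ , pull (1 + Y) e₃
    where
    F : ℕ
    F = K * (1 + j) + c
    e : ∀ F Z R → F * (Z * R) ≡ Z * (F * R)
    e = solve-∀
    pull : ∀ {W} Z → W ≡ Z * R → F * W ≡ Z * (F * R)
    pull Z eq = trans (cong (F *_) eq) (e F Z R)

  -- For s = a + 2 ≥ 2 and Y ≥ a + 1, Cauchy–Schwarz with weights a and 2 gives
  -- (a/√Y + 2/√(Y + a + 1))² ≤ s²/(Y + 1).
  coin-step : ∀ a h g Y R M → 1 + a ≤ Y → h * h * (Y * R) ≤ M → g * g * ((Y + (1 + a)) * R) ≤ 4 * M →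
              (a * h + g) * (a * h + g) * ((1 + Y) * R) ≤ (2 + a) * (2 + a) * M
  coin-step a h g Y R M K≤Y hyp₁ hyp₂ with e , refl ← m≤n⇒∃[o]m+o≡n K≤Y =
    *-cancelˡ-≤ (2 * (Y * (Y + (1 + a)))) (begin
      2 * (Y * (Y + (1 + a))) * ((a * h + g) * (a * h + g) * ((1 + Y) * R))
        ≡⟨ e₁ a e ((a * h + g) * (a * h + g)) R ⟩
      2 * ((a * h + g) * (a * h + g)) * ((1 + Y) * R * (Y * (Y + (1 + a))))
        ≤⟨ *-monoˡ-≤ ((1 + Y) * R * (Y * (Y + (1 + a)))) cauchy ⟩
      (2 + a) * (2 * a * (h * h) + g * g) * ((1 + Y) * R * (Y * (Y + (1 + a))))
        ≡⟨ e₂ a e (h * h) (g * g) R ⟩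
      (2 + a) * (1 + Y) * (2 * a * (Y + (1 + a)) * (h * h * (Y * R)) + Y * (g * g * ((Y + (1 + a)) * R)))
        ≤⟨ *-monoʳ-≤ ((2 + a) * (1 + Y)) (+-mono-≤ (*-monoʳ-≤ (2 * a * (Y + (1 + a))) hyp₁) (*-monoʳ-≤ Y hyp₂)) ⟩
      (2 + a) * (1 + Y) * (2 * a * (Y + (1 + a)) * M + Y * (4 * M))
        -- Here `e` is the excess of `Y` over `1 + a`, so the hypothesis `1 + a ≤ Y` is what makes
        -- the discarded term nonnegative.
        ≤⟨ m≤m+n _ (2 * (2 + a) * M * (a * e)) ⟩
      (2 + a) * (1 + Y) * (2 * a * (Y + (1 + a)) * M + Y * (4 * M)) + 2 * (2 + a) * M * (a * e)
        ≡⟨ e₃ a e M ⟩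
      2 * (Y * (Y + (1 + a))) * ((2 + a) * (2 + a) * M) ∎)
    where
    open ≤-Reasoning
    e₁ : ∀ a e T R → let Y = 1 + a + e in
         2 * (Y * (Y + (1 + a))) * (T * ((1 + Y) * R)) ≡ 2 * T * ((1 + Y) * R * (Y * (Y + (1 + a))))
    e₁ = solve-∀
    e₂ : ∀ a e p q R → let Y = 1 + a + e in
         (2 + a) * (2 * a * p + q) * ((1 + Y) * R * (Y * (Y + (1 + a)))) ≡
         (2 + a) * (1 + Y) * (2 * a * (Y + (1 + a)) * (p * (Y * R)) + Y * (q * ((Y + (1 + a)) * R)))
    e₂ = solve-∀
    e₃ : ∀ a e M → let Y = 1 + a + e in
         (2 + a) * (1 + Y) * (2 * a * (Y + (1 + a)) * M + Y * (4 * M)) + 2 * (2 + a) * M * (a * e) ≡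
         2 * (Y * (Y + (1 + a))) * ((2 + a) * (2 + a) * M)
    e₃ = solve-∀
    e₄ : ∀ a h g → 2 * ((a * h + g) * (a * h + g)) ≡ 2 * a * a * (h * h) + a * (2 * (2 * h * g)) + 2 * (g * g)
    e₄ = solve-∀
    e₅ : ∀ a h g → 2 * a * a * (h * h) + a * (2 * h * (2 * h) + g * g) + 2 * (g * g) ≡
         (2 + a) * (2 * a * (h * h) + g * g)
    e₅ = solve-∀
    -- Cauchy-Schwarz for `a` copies of `h` and two copies of `g / 2`, doubled to clear the
    -- fraction.
    cauchy : 2 * ((a * h + g) * (a * h + g)) ≤ (2 + a) * (2 * a * (h * h) + g * g)
    cauchy = begin
      2 * ((a * h + g) * (a * h + g))
        ≡⟨ e₄ a h g ⟩
      2 * a * a * (h * h) + a * (2 * (2 * h * g)) + 2 * (g * g)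
        ≤⟨ +-monoˡ-≤ (2 * (g * g)) (+-monoʳ-≤ (2 * a * a * (h * h)) (*-monoʳ-≤ a (2*m*n≤m*m+n*n (2 * h) g))) ⟩
      2 * a * a * (h * h) + a * (2 * h * (2 * h) + g * g) + 2 * (g * g)
        ≡⟨ e₅ a h g ⟩
      (2 + a) * (2 * a * (h * h) + g * g) ∎

  counts : ∀ {d} → List (Fin d) → Vec ℕ d
  counts []      = replicate _ 0
  counts (i ∷ L) = bump i (counts L)

  sum-bump : ∀ {d} i (j : Vec ℕ d) → Vec.sum (bump i j) ≡ suc (Vec.sum j)
  sum-bump zero    (j ∷ js) = refl
  sum-bump (suc i) (j ∷ js) = trans (cong (j +_) (sum-bump i js)) (+-suc j (Vec.sum js))

  peaks-bound : ∀ {d} K (j : Vec ℕ d) →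
                peaks j * peaks j * weight K j (replicate d 0) ≤ (3 * K) ^ d * 4 ^ Vec.sum j
  peaks-bound K []       = ≤-refl
  peaks-bound {suc d} K (j ∷ js) = begin
    p * P * (p * P) * ((K * (1 + j) + 0) * W)                ≡⟨ e₁ p P K j W ⟩
    K * (p * p * (1 + j)) * (P * P * W)                      ≤⟨ *-mono-≤ (*-monoʳ-≤ K (peak-bound j)) (peaks-bound K js) ⟩
    K * (3 * 4 ^ j) * ((3 * K) ^ d * 4 ^ Vec.sum js)         ≡⟨ e₂ K (4 ^ j) ((3 * K) ^ d) (4 ^ Vec.sum js) ⟩
    3 * K * (3 * K) ^ d * (4 ^ j * 4 ^ Vec.sum js)           ≡⟨ cong (3 * K * (3 * K) ^ d *_) (^-distribˡ-+-* 4 j (Vec.sum js)) ⟨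
    3 * K * (3 * K) ^ d * 4 ^ (j + Vec.sum js)               ∎
    where
    open ≤-Reasoning
    p P W : ℕ
    p = peak j
    P = peaks js
    W = weight K js (replicate d 0)
    e₁ : ∀ p P K j W → p * P * (p * P) * ((K * (1 + j) + 0) * W) ≡ K * (p * p * (1 + j)) * (P * P * W)
    e₁ = solve-∀
    e₂ : ∀ K x y z → K * (3 * x) * (y * z) ≡ 3 * K * y * (x * z)
    e₂ = solve-∀

  -- Examining direction `i` replaces the factor `1 + Y` by `Y` if no coin is tossed and by
  -- `Y + (1 + a)` if one is; `coin-step` combines the two cases at the cost of `(2 + a) * (2 + a)`.
  -- The factor 4 per coin accounts for its two outcomes, squared.
  majorant-bound : ∀ {d} a L (j : Vec ℕ d) →
    majorant a L j * majorant a L j * weight (1 + a) j (counts L) ≤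
    (3 * (1 + a)) ^ d * 4 ^ Vec.sum j * (2 + a) ^ (2 * length L)
  majorant-bound a []      j = ≤-trans (peaks-bound (1 + a) j) (≤-reflexive (sym (*-identityʳ _)))
  majorant-bound {d} a (i ∷ L) j with weight-split (1 + a) i j (counts L)
  ... | Y , R , K≤Y , e₁ , e₂ , e₃ = begin
    (a * h + g) * (a * h + g) * weight (1 + a) j (bump i (counts L))   ≡⟨ cong ((a * h + g) * (a * h + g) *_) e₃ ⟩
    (a * h + g) * (a * h + g) * ((1 + Y) * R)       ≤⟨ coin-step a h g Y R (B * q * t) K≤Y hyp₁ hyp₂ ⟩
    (2 + a) * (2 + a) * (B * q * t)                 ≡⟨ e₄ (2 + a) (B * q) t ⟩
    B * q * ((2 + a) * ((2 + a) * t))               ≡⟨ cong (λ r → B * q * (2 + a) ^ r) (*-suc 2 (length L)) ⟨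
    B * q * (2 + a) ^ (2 * suc (length L))          ∎
    where
    open ≤-Reasoning
    h g B q t : ℕ
    h = majorant a L j
    g = majorant a L (bump i j)
    B = (3 * (1 + a)) ^ d
    q = 4 ^ Vec.sum j
    t = (2 + a) ^ (2 * length L)
    e₄ : ∀ s c t → s * s * (c * t) ≡ c * (s * (s * t))
    e₄ = solve-∀
    e₅ : ∀ c q t → c * (4 * q) * t ≡ 4 * (c * q * t)
    e₅ = solve-∀
    hyp₁ : h * h * (Y * R) ≤ B * q * t
    hyp₁ = subst (λ w → h * h * w ≤ B * q * t) e₁ (majorant-bound a L j)
    hyp₂ : g * g * ((Y + (1 + a)) * R) ≤ 4 * (B * q * t)
    hyp₂ = subst₂ (λ w r → g * g * w ≤ r) e₂
      (trans (cong (λ r → B * 4 ^ r * t) (sum-bump i j)) (e₅ B q t)) (majorant-bound a L (bump i j))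

  lookup-bump-≥ : ∀ {d} i (j : Vec ℕ d) l → lookup j l ≤ lookup (bump i j) l
  lookup-bump-≥ zero    (j ∷ js) zero    = n≤1+n j
  lookup-bump-≥ zero    (j ∷ js) (suc l) = ≤-refl
  lookup-bump-≥ (suc i) (j ∷ js) zero    = ≤-refl
  lookup-bump-≥ (suc i) (j ∷ js) (suc l) = lookup-bump-≥ i js l

  lookup-bump : ∀ {d} i (j : Vec ℕ d) → lookup (bump i j) i ≡ suc (lookup j i)
  lookup-bump zero    (j ∷ js) = refl
  lookup-bump (suc i) (j ∷ js) = lookup-bump i js

  counts-++-≥ : ∀ {d} (xs L : List (Fin d)) l → lookup (counts L) l ≤ lookup (counts (xs ++ L)) l
  counts-++-≥ []       L l = ≤-refl
  counts-++-≥ (i ∷ xs) L l = ≤-trans (counts-++-≥ xs L l) (lookup-bump-≥ i (counts (xs ++ L)) l)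

  counts-∈ : ∀ {d} {xs : List (Fin d)} {l} → l ∈ xs → ∀ L → suc (lookup (counts L) l) ≤ lookup (counts (xs ++ L)) l
  counts-∈ {xs = i ∷ xs} {l} (here refl) L =
    ≤-trans (s≤s (counts-++-≥ xs L l)) (≤-reflexive (sym (lookup-bump i (counts (xs ++ L)))))
  counts-∈ {xs = i ∷ xs} {l} (there l∈) L =
    ≤-trans (counts-∈ l∈ L) (lookup-bump-≥ i (counts (xs ++ L)) l)

  -- A schedule of directions: `k` full rounds, with the `r` leftover times given to direction
  -- `zero`.
  rounds : ∀ d → ℕ → ℕ → List (Fin (suc d))
  rounds d zero    r = List.replicate r zero
  rounds d (suc k) r = allFin (suc d) ++ rounds d k r

  length-rounds : ∀ d k r → length (rounds d k r) ≡ r + k * suc d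
  length-rounds d zero    r = trans (length-replicate r) (sym (+-identityʳ r))
  length-rounds d (suc k) r = begin
    length (allFin (suc d) ++ rounds d k r)             ≡⟨ length-++ (allFin (suc d)) ⟩
    length (allFin (suc d)) + length (rounds d k r)     ≡⟨ cong₂ _+_ (length-tabulate {n = suc d} (λ i → i)) (length-rounds d k r) ⟩
    suc d + (r + k * suc d)                             ≡⟨ e (suc d) r (k * suc d) ⟩
    r + (suc d + k * suc d)                             ∎
    where
    open ≡-Reasoning
    e : ∀ a b c → a + (b + c) ≡ b + (a + c)
    e = solve-∀

  counts-rounds : ∀ d k r i → k ≤ lookup (counts (rounds d k r)) i
  counts-rounds d zero    r i = z≤n
  counts-rounds d (suc k) r i = ≤-trans (s≤s (counts-rounds d k r i)) (counts-∈ (∈-allFin i) (rounds d k r))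

  weight-≥ : ∀ {d} a D n (c : Vec ℕ d) → (∀ i → n ≤ D * (1 + lookup c i)) →
             n ^ d ≤ D ^ d * weight (1 + a) (replicate d 0) c
  weight-≥ a D n []       le = ≤-refl
  weight-≥ {suc d} a D n (c ∷ cs) le = begin
    n * n ^ d                                                              ≤⟨ *-mono-≤ (le zero) (weight-≥ a D n cs (λ i → le (suc i))) ⟩
    D * (1 + c) * (D ^ d * weight (1 + a) (replicate d 0) cs)              ≤⟨ *-monoˡ-≤ _ (*-monoʳ-≤ D (+-monoˡ-≤ c (s≤s z≤n))) ⟩
    D * ((1 + a) * 1 + c) * (D ^ d * weight (1 + a) (replicate d 0) cs)    ≡⟨ e D ((1 + a) * 1 + c) (D ^ d) _ ⟩
    D * D ^ d * (((1 + a) * 1 + c) * weight (1 + a) (replicate d 0) cs)    ∎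
    where
    open ≤-Reasoning
    e : ∀ D x y z → D * x * (y * z) ≡ D * y * (x * z)
    e = solve-∀

  sum-replicate-0 : ∀ d → Vec.sum (replicate d 0) ≡ 0
  sum-replicate-0 zero    = refl
  sum-replicate-0 (suc d) = sum-replicate-0 d

  -- Division of `n` by `D` yields a schedule of length `n` in which every direction is examined at
  -- least `n / D` times. Every factor of the initial weight is then at least the exact quotient of
  -- `n` by `D`, hence the power `n ^ D`.
  walks-upper : ∀ {d} (S : List (Vec PM (suc d))) → Flippable S → ∀ {a} → length S ≡ 2 + a → ∀ n x →
                walks S small n x * walks S small n x * n ^ suc d ≤
                suc d ^ suc d * (3 * (1 + a)) ^ suc d * (2 + a) ^ (2 * n)
  walks-upper {d} S flip {a} len n x = begin
    N * N * n ^ D                                       ≤⟨ *-mono-≤ (*-mono-≤ N≤H N≤H) (weight-≥ a D n (counts L) n≤) ⟩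
    H * H * (D ^ D * w)                                 ≡⟨ e (H * H) (D ^ D) w ⟩
    D ^ D * (H * H * w)                                 ≤⟨ *-monoʳ-≤ (D ^ D) (majorant-bound a L (replicate D 0)) ⟩
    D ^ D * ((3 * (1 + a)) ^ D * 4 ^ Vec.sum (replicate D 0) * (2 + a) ^ (2 * length L))
      ≡⟨ cong₂ (λ r r′ → D ^ D * ((3 * (1 + a)) ^ D * 4 ^ r * (2 + a) ^ (2 * r′))) (sum-replicate-0 D) len-L ⟩
    D ^ D * ((3 * (1 + a)) ^ D * 1 * (2 + a) ^ (2 * n)) ≡⟨ e′ (D ^ D) ((3 * (1 + a)) ^ D) _ ⟩
    D ^ D * (3 * (1 + a)) ^ D * (2 + a) ^ (2 * n)       ∎
    where
    open ≤-Reasoning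
    D : ℕ
    D = suc d
    L : List (Fin D)
    L = rounds d (n / D) (n % D)
    len-L : length L ≡ n
    len-L = trans (length-rounds d (n / D) (n % D)) (sym (m≡m%n+[m/n]*n n D))
    N H w : ℕ
    N = walks S small n x
    H = majorant a L (replicate D 0)
    w = weight (1 + a) (replicate D 0) (counts L)
    N≤H : N ≤ H
    N≤H = subst (λ k → walks S small k x ≤ H) len-L (walks≤majorant S flip len L (replicate D 0) x)
    e : ∀ a b c → a * (b * c) ≡ b * (a * c)
    e = solve-∀
    e′ : ∀ a b c → a * (b * 1 * c) ≡ a * b * c
    e′ = solve-∀
    n≤ : ∀ i → n ≤ D * (1 + lookup (counts L) i)
    n≤ i = begin
      n                                 ≡⟨ m≡m%n+[m/n]*n n D ⟩
      n % D + n / D * D                 ≤⟨ +-monoˡ-≤ (n / D * D) (<⇒≤ (m%n<n n D)) ⟩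
      D + n / D * D                     ≡⟨ *-comm (suc (n / D)) D ⟩
      D * (1 + n / D)                   ≤⟨ *-monoʳ-≤ D (s≤s (counts-rounds d (n / D) (n % D) i)) ⟩
      D * (1 + lookup (counts L) i)     ∎

  -- Lower bound

  walks-cong : ∀ {d} (S : List (Vec PM d)) {f g : Vec ℤ d → ℕ} → (∀ x → f x ≡ g x) →
               ∀ n x → walks S f n x ≡ walks S g n x
  walks-cong S eq zero    x = eq x
  walks-cong S eq (suc n) x = ∑-cong S (λ v → walks-cong S eq n (x ⊕ v))

  walks-mono : ∀ {d} (S : List (Vec PM d)) {f g : Vec ℤ d → ℕ} → (∀ x → f x ≤ g x) →
               ∀ n x → walks S f n x ≤ walks S g n x
  walks-mono S le zero    x = le x
  walks-mono S le (suc n) x = ∑-mono S (λ v → walks-mono S le n (x ⊕ v))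

  walks-+ : ∀ {d} (S : List (Vec PM d)) (f g : Vec ℤ d → ℕ) n x →
            walks S (λ y → f y + g y) n x ≡ walks S f n x + walks S g n x
  walks-+ S f g zero    x = refl
  walks-+ S f g (suc n) x = trans (∑-cong S (λ v → walks-+ S f g n (x ⊕ v))) (∑-+ S _ _)

  walks-*ˡ : ∀ {d} (S : List (Vec PM d)) c (f : Vec ℤ d → ℕ) n x →
             walks S (λ y → c * f y) n x ≡ c * walks S f n x
  walks-*ˡ S c f zero    x = refl
  walks-*ˡ S c f (suc n) x = trans (∑-cong S (λ v → walks-*ˡ S c f n (x ⊕ v))) (∑-*ˡ S c _)

  walks-const : ∀ {d} (S : List (Vec PM d)) c n x → walks S (λ _ → c) n x ≡ length S ^ n * c
  walks-const S c zero    x = sym (+-identityʳ c)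
  walks-const S c (suc n) x = begin
    ∑ S (λ v → walks S (λ _ → c) n (x ⊕ v))     ≡⟨ ∑-cong S (λ v → walks-const S c n (x ⊕ v)) ⟩
    ∑ S (λ _ → length S ^ n * c)                ≡⟨ ∑-const S _ ⟩
    length S * (length S ^ n * c)               ≡⟨ *-assoc (length S) (length S ^ n) c ⟨
    length S * length S ^ n * c                 ∎
    where open ≡-Reasoning

  walks-∑ : ∀ {d} (S : List (Vec PM d)) {A : Set} (qs : List A) (f : A → Vec ℤ d → ℕ) n x →
            walks S (λ y → ∑ qs (λ q → f q y)) n x ≡ ∑ qs (λ q → walks S (f q) n x)
  walks-∑ S qs f zero    x = refl
  walks-∑ S qs f (suc n) x =
    trans (∑-cong S (λ v → walks-∑ S qs f n (x ⊕ v))) (∑-swap S qs (λ v q → walks S (f q) n (x ⊕ v)))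

  walks-+-steps : ∀ {d} (S : List (Vec PM d)) f l k x → walks S f (l + k) x ≡ walks S (walks S f k) l x
  walks-+-steps S f zero    k x = refl
  walks-+-steps S f (suc l) k x = ∑-cong S (λ v → walks-+-steps S f l k (x ⊕ v))

  ⊕-swap : ∀ {d} (x : Vec ℤ d) v w → x ⊕ v ⊕ w ≡ x ⊕ w ⊕ v
  ⊕-swap []      []      []      = refl
  ⊕-swap (z ∷ x) (p ∷ v) (q ∷ w) = cong₂ _∷_ (e z (val p) (val q)) (⊕-swap x v w)
    where
    e : ∀ z a b → z ℤ.+ a ℤ.+ b ≡ z ℤ.+ b ℤ.+ a
    e = ℤ-solve-∀

  walks-⊕ : ∀ {d} (S : List (Vec PM d)) f n x v → walks S f n (x ⊕ v) ≡ walks S (λ y → f (y ⊕ v)) n x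
  walks-⊕ S f zero    x v = refl
  walks-⊕ S f (suc n) x v =
    ∑-cong S (λ w → trans (cong (walks S f n) (⊕-swap x v w)) (walks-⊕ S f n (x ⊕ w) v))

  -- Symmetric step sets and time reversal

  opposite : PM → PM
  opposite plus1  = minus1
  opposite minus1 = plus1

  negate : ∀ {d} → Vec PM d → Vec PM d
  negate = Vec.map opposite

  -- Invariance of every sum says that negation permutes `S` as a multiset, without naming a
  -- permutation.
  Symmetric : ∀ {d} → List (Vec PM d) → Set
  Symmetric S = ∀ f → ∑ S (f ∘ negate) ≡ ∑ S f

  []¹-yes : {P : Set} (p : Dec P) → P → [ p ]¹ ≡ 1
  []¹-yes (yes _) _ = refl
  []¹-yes (no ¬p) p = ⊥-elim (¬p p)

  []¹-no : {P : Set} (p : Dec P) → ¬ P → [ p ]¹ ≡ 0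
  []¹-no (yes p) ¬p = ⊥-elim (¬p p)
  []¹-no (no _)  _  = refl

  at : ∀ {d} → Vec ℤ d → Vec ℤ d → ℕ
  at []      []      = 1
  at (z ∷ x) (y ∷ e) = [ z ℤ.≟ y ]¹ * at x e

  at-sym : ∀ {d} (x e : Vec ℤ d) → at x e ≡ at e x
  at-sym []      []      = refl
  at-sym (z ∷ x) (y ∷ e) = cong₂ _*_ ([]¹-⇔ sym sym (z ℤ.≟ y) (y ℤ.≟ z)) (at-sym x e)

  at-subst : ∀ {d} (x e : Vec ℤ d) (g : Vec ℤ d → ℕ) → at x e * g x ≡ at x e * g e
  at-subst []      []      g = refl
  at-subst (z ∷ x) (y ∷ e) g with z ℤ.≟ y
  ... | yes refl rewrite +-identityʳ (at x e) = at-subst x e (g ∘ (z ∷_))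
  ... | no  _    = refl

  val-opposite : ∀ z p → z ℤ.+ val p ℤ.+ val (opposite p) ≡ z
  val-opposite z plus1  = e z
    where
    e : ∀ z → z ℤ.+ ℤ.1ℤ ℤ.+ ℤ.-1ℤ ≡ z
    e = ℤ-solve-∀
  val-opposite z minus1 = e z
    where
    e : ∀ z → z ℤ.+ ℤ.-1ℤ ℤ.+ ℤ.1ℤ ≡ z
    e = ℤ-solve-∀

  opposite-involutive : ∀ p → opposite (opposite p) ≡ p
  opposite-involutive plus1  = refl
  opposite-involutive minus1 = refl

  at-⊕ : ∀ {d} (e y : Vec ℤ d) v → at (e ⊕ v) y ≡ at e (y ⊕ negate v)
  at-⊕ []      []      []      = refl
  at-⊕ (z ∷ e) (y ∷ x) (p ∷ v) = cong₂ _*_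
    ([]¹-⇔ (λ { refl → sym (val-opposite z p) })
           (λ { refl → trans (cong (λ q → y ℤ.+ val (opposite p) ℤ.+ val q) (sym (opposite-involutive p)))
                             (val-opposite y (opposite p)) })
           (z ℤ.+ val p ℤ.≟ y) (z ℤ.≟ y ℤ.+ val (opposite p)))
    (at-⊕ e x v)

  -- A walk from `y` to `x` read backwards uses the negated steps, which symmetry exchanges for the
  -- steps themselves. In the induction the first step of one walk becomes the last step of the
  -- other.
  walks-reverse : ∀ {d} {S : List (Vec PM d)} → Symmetric S → ∀ k x y → walks S (at x) k y ≡ walks S (at y) k x
  walks-reverse         symS zero    x y = at-sym x y
  walks-reverse {S = S} symS (suc k) x y = begin
    ∑ S (λ v → walks S (at x) k (y ⊕ v))                  ≡⟨ ∑-cong S (λ v → walks-reverse {S = S} symS k x (y ⊕ v)) ⟩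
    ∑ S (λ v → walks S (at (y ⊕ v)) k x)                  ≡⟨ symS _ ⟨
    ∑ S (λ v → walks S (at (y ⊕ negate v)) k x)           ≡⟨ ∑-cong S (λ v → walks-cong S (move v) k x) ⟩
    ∑ S (λ v → walks S (λ e → at y (e ⊕ v)) k x)          ≡⟨ ∑-cong S (λ v → walks-⊕ S (at y) k x v) ⟨
    ∑ S (λ v → walks S (at y) k (x ⊕ v))                  ∎
    where
    open ≡-Reasoning
    move : ∀ v e → at (y ⊕ negate v) e ≡ at y (e ⊕ v)
    move v e = trans (at-sym (y ⊕ negate v) e) (trans (sym (at-⊕ e y v)) (at-sym (e ⊕ v) y))

  -- Boxes and the second moment of a walk

  range : ℕ → List ℤ
  range zero    = 0ℤ ∷ []
  range (suc R) = ℤ.+ suc R ∷ -[1+ R ] ∷ range R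

  length-range : ∀ R → length (range R) ≡ 1 + 2 * R
  length-range zero    = refl
  length-range (suc R) = trans (cong (2 +_) (length-range R)) (e R)
    where
    e : ∀ R → 2 + (1 + 2 * R) ≡ 1 + 2 * suc R
    e = solve-∀

  -- The indicator of the interval from `-R` to `R`, written as a sum over its points so that
  -- summation over the box can be exchanged with summation over walks.
  hits : ℕ → ℤ → ℕ
  hits R y = ∑ (range R) (λ z → [ z ℤ.≟ y ]¹)

  hits-out : ∀ R y → R < ∣ y ∣ → hits R y ≡ 0
  hits-out zero    y R<y = trans (+-identityʳ _) ([]¹-no (0ℤ ℤ.≟ y) λ { refl → <-irrefl refl R<y })
  hits-out (suc R) y R<y = cong₂ _+_ ([]¹-no (ℤ.+ suc R ℤ.≟ y) λ { refl → <-irrefl refl R<y })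
    (cong₂ _+_ ([]¹-no (-[1+ R ] ℤ.≟ y) λ { refl → <-irrefl refl R<y }) (hits-out R y (<-trans (n<1+n R) R<y)))

  hits-in : ∀ R y → ∣ y ∣ ≤ R → hits R y ≡ 1
  hits-in zero y y≤R = trans (+-identityʳ _) ([]¹-yes (0ℤ ℤ.≟ y) (sym (ℤ.∣i∣≡0⇒i≡0 (n≤0⇒n≡0 y≤R))))
  hits-in (suc R) y y≤R with m≤n⇒m<n∨m≡n y≤R
  ... | inj₁ (s≤s y≤R′) = cong₂ _+_ ([]¹-no (ℤ.+ suc R ℤ.≟ y) λ { refl → <-irrefl refl y≤R′ })
    (cong₂ _+_ ([]¹-no (-[1+ R ] ℤ.≟ y) λ { refl → <-irrefl refl y≤R′ }) (hits-in R y y≤R′))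
  hits-in (suc R) (ℤ.+ .(suc R)) y≤R | inj₂ refl = cong₂ _+_ ([]¹-yes (ℤ.+ suc R ℤ.≟ ℤ.+ suc R) refl)
    (cong₂ _+_ ([]¹-no (-[1+ R ] ℤ.≟ ℤ.+ suc R) λ ()) (hits-out R (ℤ.+ suc R) (n<1+n R)))
  hits-in (suc R) -[1+ .R ] y≤R | inj₂ refl = cong₂ _+_ ([]¹-no (ℤ.+ suc R ℤ.≟ -[1+ R ]) λ ())
    (cong₂ _+_ ([]¹-yes (-[1+ R ] ℤ.≟ -[1+ R ]) refl) (hits-out R -[1+ R ] (n<1+n R)))

  inBox : ∀ {d} → ℕ → Vec ℤ d → ℕ
  inBox R []      = 1
  inBox R (y ∷ e) = hits R y * inBox R e

  square : ℤ → ℕ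
  square z = ∣ z ∣ * ∣ z ∣

  norm² : ∀ {d} → Vec ℤ d → ℕ
  norm² []      = 0
  norm² (y ∷ e) = square y + norm² e

  inBox≤1 : ∀ {d} R (e : Vec ℤ d) → inBox R e ≤ 1
  inBox≤1 R []      = ≤-refl
  inBox≤1 R (y ∷ e) with ∣ y ∣ ≤? R
  ... | yes y≤R rewrite hits-in R y y≤R | +-identityʳ (inBox R e) = inBox≤1 R e
  ... | no  y≰R rewrite hits-out R y (≰⇒> y≰R) = z≤n

  -- The pointwise form of Chebyshev's inequality: a point outside the box has a coordinate of
  -- absolute value at least `1 + R`.
  chebyshev : ∀ {d} R (e : Vec ℤ d) →
              (1 + R) * (1 + R) ≤ (1 + R) * (1 + R) * inBox R e + norm² e
  chebyshev R []      = ≤-trans (≤-reflexive (sym (*-identityʳ _))) (m≤m+n _ 0)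
  chebyshev R (y ∷ e) with ∣ y ∣ ≤? R
  ... | yes y≤R rewrite hits-in R y y≤R | +-identityʳ (inBox R e) =
    ≤-trans (chebyshev R e) (+-monoʳ-≤ ((1 + R) * (1 + R) * inBox R e) (m≤n+m (norm² e) (square y)))
  ... | no  y≰R = ≤-trans (*-mono-≤ (≰⇒> y≰R) (≰⇒> y≰R))
    (≤-trans (m≤m+n (square y) (norm² e)) (m≤n+m (square y + norm² e) ((1 + R) * (1 + R) * inBox R (y ∷ e))))

  ∑-at : ∀ R {d} (e : Vec ℤ d) → ∑ (allVecs (range R) d) (λ q → at q e) ≡ inBox R e
  ∑-at R []                = refl
  ∑-at R {suc d} (y ∷ e) = begin
    ∑ (allVecs (range R) (suc d)) (λ q → at q (y ∷ e))
      ≡⟨ ∑-allVecs (range R) d _ ⟩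
    ∑ (range R) (λ z → ∑ (allVecs (range R) d) (λ q → [ z ℤ.≟ y ]¹ * at q e))
      ≡⟨ ∑-cong (range R) (λ z → trans (∑-*ˡ (allVecs (range R) d) [ z ℤ.≟ y ]¹ _)
           (trans (cong ([ z ℤ.≟ y ]¹ *_) (∑-at R e)) (*-comm [ z ℤ.≟ y ]¹ (inBox R e)))) ⟩
    ∑ (range R) (λ z → inBox R e * [ z ℤ.≟ y ]¹)
      ≡⟨ ∑-*ˡ (range R) (inBox R e) _ ⟩
    inBox R e * hits R y
      ≡⟨ *-comm (inBox R e) (hits R y) ⟩
    hits R y * inBox R e ∎
    where open ≡-Reasoning

  length-allVecs : {A : Set} (xs : List A) (n : ℕ) → length (allVecs xs n) ≡ length xs ^ n
  length-allVecs xs zero    = refl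
  length-allVecs xs (suc n) = begin
    length (allVecs xs (suc n))                   ≡⟨ length-∑ (allVecs xs (suc n)) ⟩
    ∑ (allVecs xs (suc n)) (λ _ → 1)              ≡⟨ ∑-allVecs xs n (λ _ → 1) ⟩
    ∑ xs (λ _ → ∑ (allVecs xs n) (λ _ → 1))       ≡⟨ ∑-const xs _ ⟩
    length xs * ∑ (allVecs xs n) (λ _ → 1)        ≡⟨ cong (length xs *_) (trans (sym (length-∑ (allVecs xs n))) (length-allVecs xs n)) ⟩
    length xs * length xs ^ n                     ∎
    where open ≡-Reasoning

  square-neighbours : ∀ z → square (z ℤ.+ val plus1) + square (z ℤ.+ val minus1) ≡ 2 * (square z + 1)
  square-neighbours (ℤ.+ zero) = refl
  square-neighbours (ℤ.+ suc n) = e n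
    where
    e : ∀ n → (suc n + 1) * (suc n + 1) + n * n ≡ 2 * (suc n * suc n + 1)
    e = solve-∀
  square-neighbours -[1+ zero ] = refl
  square-neighbours -[1+ suc n ] = e n
    where
    e : ∀ n → suc n * suc n + suc (suc (suc n + 0)) * suc (suc (suc n + 0)) ≡ 2 * (suc (suc n) * suc (suc n) + 1)
    e = solve-∀

  square-step : ∀ z p → square (z ℤ.+ val p) + square (z ℤ.+ val (opposite p)) ≡ 2 * (square z + 1)
  square-step z plus1  = square-neighbours z
  square-step z minus1 = trans (+-comm (square (z ℤ.+ val minus1)) _) (square-neighbours z)

  norm²-step : ∀ {d} (x : Vec ℤ d) v → norm² (x ⊕ v) + norm² (x ⊕ negate v) ≡ 2 * (norm² x + d)
  norm²-step []      []      = refl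
  norm²-step {suc d} (z ∷ x) (p ∷ v) = begin
    square (z ℤ.+ val p) + norm² (x ⊕ v) + (square (z ℤ.+ val (opposite p)) + norm² (x ⊕ negate v))
      ≡⟨ e₁ (square (z ℤ.+ val p)) (norm² (x ⊕ v)) (square (z ℤ.+ val (opposite p))) (norm² (x ⊕ negate v)) ⟩
    square (z ℤ.+ val p) + square (z ℤ.+ val (opposite p)) + (norm² (x ⊕ v) + norm² (x ⊕ negate v))
      ≡⟨ cong₂ _+_ (square-step z p) (norm²-step x v) ⟩
    2 * (square z + 1) + 2 * (norm² x + d)
      ≡⟨ e₂ (square z) (norm² x) d ⟩
    2 * (square z + norm² x + suc d) ∎
    where
    open ≡-Reasoning
    e₁ : ∀ a b c d → a + b + (c + d) ≡ a + c + (b + d)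
    e₁ = solve-∀
    e₂ : ∀ a b d → 2 * (a + 1) + 2 * (b + d) ≡ 2 * (a + b + suc d)
    e₂ = solve-∀

  -- The steps `v` and `negate v` are paired; by the parallelogram identity their cross terms
  -- cancel, and the mean of `norm²` grows by `d` in each step.
  ∑-norm² : ∀ {d} {S : List (Vec PM d)} → Symmetric S → ∀ x →
            ∑ S (λ v → norm² (x ⊕ v)) ≡ length S * (norm² x + d)
  ∑-norm² {d} {S} symS x = *-cancelˡ-≡ _ _ 2 (begin
    2 * ∑ S N                             ≡⟨ cong (∑ S N +_) (trans (+-identityʳ (∑ S N)) (sym (symS N))) ⟩
    ∑ S N + ∑ S (N ∘ negate)              ≡⟨ ∑-+ S N (N ∘ negate) ⟨
    ∑ S (λ v → N v + N (negate v))        ≡⟨ ∑-cong S (norm²-step x) ⟩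
    ∑ S (λ _ → 2 * (norm² x + d))         ≡⟨ ∑-const S _ ⟩
    length S * (2 * (norm² x + d))        ≡⟨ e (length S) (norm² x + d) ⟩
    2 * (length S * (norm² x + d))        ∎)
    where
    open ≡-Reasoning
    N : Vec PM d → ℕ
    N v = norm² (x ⊕ v)
    e : ∀ a b → a * (2 * b) ≡ 2 * (a * b)
    e = solve-∀

  walks-norm² : ∀ {d} {S : List (Vec PM d)} → Symmetric S → ∀ k x →
                walks S norm² k x ≡ length S ^ k * (norm² x + k * d)
  walks-norm²             symS zero    x = sym (trans (+-identityʳ _) (+-identityʳ _))
  walks-norm² {d} {S} symS (suc k) x = begin
    ∑ S (λ v → walks S norm² k (x ⊕ v))                       ≡⟨ ∑-cong S (λ v → walks-norm² symS k (x ⊕ v)) ⟩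
    ∑ S (λ v → T * (norm² (x ⊕ v) + k * d))                   ≡⟨ ∑-*ˡ S T _ ⟩
    T * ∑ S (λ v → norm² (x ⊕ v) + k * d)                     ≡⟨ cong (T *_) (∑-+ S _ _) ⟩
    T * (∑ S (λ v → norm² (x ⊕ v)) + ∑ S (λ _ → k * d))       ≡⟨ cong (T *_) (cong₂ _+_ (∑-norm² {S = S} symS x) (∑-const S (k * d))) ⟩
    T * (length S * (norm² x + d) + length S * (k * d))       ≡⟨ e T (length S) (norm² x) d k ⟩
    length S * T * (norm² x + (d + k * d))                    ∎
    where
    open ≡-Reasoning
    T : ℕ
    T = length S ^ k
    e : ∀ T s a d k → T * (s * (a + d) + s * (k * d)) ≡ s * T * (a + (d + k * d))
    e = solve-∀

  norm²-origin : ∀ d → norm² (origin {d}) ≡ 0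
  norm²-origin zero    = refl
  norm²-origin (suc d) = norm²-origin d

  √ : ∀ n → ∃ λ r → r * r ≤ n × n < (1 + r) * (1 + r)
  √ zero = 0 , z≤n , s≤s z≤n
  √ (suc n) with √ n
  ... | r , r²≤n , n<[1+r]² with (1 + r) * (1 + r) ≤? suc n
  ...   | yes le = 1 + r , le , ≤-trans (s≤s n<[1+r]²) (*-mono-< (n<1+n (1 + r)) (n<1+n (1 + r)))
  ...   | no ¬le = r , m≤n⇒m≤1+n r²≤n , ≰⇒> ¬le

  ^-distribʳ-* : ∀ n a b → (a * b) ^ n ≡ a ^ n * b ^ n
  ^-distribʳ-* zero    a b = refl
  ^-distribʳ-* (suc n) a b = trans (cong (a * b *_) (^-distribʳ-* n a b)) (e a b (a ^ n) (b ^ n))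
    where
    e : ∀ a b x y → a * b * (x * y) ≡ a * x * (b * y)
    e = solve-∀

  returns : ∀ {d} → List (Vec PM d) → ℕ → ℕ
  returns S k = walks S (at origin) (k + k) origin

  -- Cauchy-Schwarz over the `(1 + 2 * R) ^ d` points of the box leaves the pairs of `k`-step walks
  -- with a common endpoint in it. Reversing the second walk of such a pair gives a closed walk of
  -- length `k + k`.
  inBox²≤returns : ∀ {d} {S : List (Vec PM d)} → Symmetric S → ∀ R k →
                   walks S (inBox R) k origin * walks S (inBox R) k origin ≤ (1 + 2 * R) ^ d * returns S k
  inBox²≤returns {d} {S} symS R k = begin
    W (inBox R) * W (inBox R)                     ≡⟨ cong₂ _*_ W-inBox W-inBox ⟩
    ∑ Q end * ∑ Q end                             ≤⟨ ∑-Cauchy Q end ⟩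
    length Q * ∑ Q (λ q → end q * end q)          ≡⟨ cong₂ _*_ length-Q collisions ⟩
    (1 + 2 * R) ^ d * W (λ e → end e * inBox R e) ≤⟨ *-monoʳ-≤ ((1 + 2 * R) ^ d) (walks-mono S (λ e → ≤-trans (*-monoʳ-≤ (end e) (inBox≤1 R e)) (≤-reflexive (*-identityʳ (end e)))) k origin) ⟩
    (1 + 2 * R) ^ d * W end                       ≡⟨ cong ((1 + 2 * R) ^ d *_) (walks-cong S (λ e → walks-reverse {S = S} symS k e origin) k origin) ⟩
    (1 + 2 * R) ^ d * W (walks S (at origin) k)   ≡⟨ cong ((1 + 2 * R) ^ d *_) (walks-+-steps S (at origin) k k origin) ⟨
    (1 + 2 * R) ^ d * returns S k                 ∎
    where
    open ≤-Reasoning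
    W : (Vec ℤ d → ℕ) → ℕ
    W f = walks S f k origin
    Q : List (Vec ℤ d)
    Q = allVecs (range R) d
    end : Vec ℤ d → ℕ
    end q = W (at q)
    W-inBox : W (inBox R) ≡ ∑ Q end
    W-inBox = trans (walks-cong S (λ e → sym (∑-at R e)) k origin) (walks-∑ S Q at k origin)
    length-Q : length Q ≡ (1 + 2 * R) ^ d
    length-Q = trans (length-allVecs (range R) d) (cong (_^ d) (length-range R))
    -- The constant `end q` moves inside the walk, where it may be evaluated at the endpoint `e`;
    -- the sum over `q` then acts on `at q e` alone.
    concentrate : ∀ q → end q * end q ≡ W (λ e → end e * at q e)
    concentrate q = trans (sym (walks-*ˡ S (end q) (at q) k origin))
      (walks-cong S (λ e → trans (*-comm (end q) (at q e)) (trans (at-subst q e end) (*-comm (at q e) (end e)))) k origin)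
    collisions : ∑ Q (λ q → end q * end q) ≡ W (λ e → end e * inBox R e)
    collisions = begin-equality
      ∑ Q (λ q → end q * end q)               ≡⟨ ∑-cong Q concentrate ⟩
      ∑ Q (λ q → W (λ e → end e * at q e))    ≡⟨ walks-∑ S Q (λ q e → end e * at q e) k origin ⟨
      W (λ e → ∑ Q (λ q → end e * at q e))    ≡⟨ walks-cong S (λ e → trans (∑-*ˡ Q (end e) (λ q → at q e)) (cong (end e *_) (∑-at R e))) k origin ⟩
      W (λ e → end e * inBox R e)             ∎

  -- The sum of `chebyshev` over all walks bounds the walks leaving the box by their second moment
  -- `T * (k * d)`, which is at most half of `X * T`.
  half-inBox : ∀ {d} {S : List (Vec PM d)} → Symmetric S → ∀ R k → 2 * (k * d) ≤ (1 + R) * (1 + R) →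
               length S ^ k ≤ 2 * walks S (inBox R) k origin
  half-inBox {d} {S} symS R k large = *-cancelˡ-≤ X (+-cancelʳ-≤ (X * T) _ _ (begin
    X * T + X * T                       ≡⟨ e₁ X T ⟩
    2 * (T * X)                         ≡⟨ cong (2 *_) (walks-const S X k origin) ⟨
    2 * W (λ _ → X)                     ≤⟨ *-monoʳ-≤ 2 (walks-mono S (chebyshev R) k origin) ⟩
    2 * W (λ e → X * inBox R e + norm² e)
      ≡⟨ cong (2 *_) (trans (walks-+ S _ norm² k origin) (cong₂ _+_ (walks-*ˡ S X (inBox R) k origin) second)) ⟩
    2 * (X * I + T * (k * d))           ≡⟨ e₂ X I T (k * d) ⟩
    X * (2 * I) + 2 * (k * d) * T       ≤⟨ +-monoʳ-≤ (X * (2 * I)) (*-monoˡ-≤ T large) ⟩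
    X * (2 * I) + X * T                 ∎))
    where
    open ≤-Reasoning
    W : (Vec ℤ d → ℕ) → ℕ
    W f = walks S f k origin
    X T I : ℕ
    X = (1 + R) * (1 + R)
    T = length S ^ k
    I = W (inBox R)
    second : W norm² ≡ T * (k * d)
    second = trans (walks-norm² {S = S} symS k origin) (cong (λ r → T * (r + k * d)) (norm²-origin d))
    e₁ : ∀ X T → X * T + X * T ≡ 2 * (T * X)
    e₁ = solve-∀
    e₂ : ∀ X I T m → 2 * (X * I + T * m) ≡ X * (2 * I) + 2 * m * T
    e₂ = solve-∀

  -- `R` is the integer square root of `2 * (k * D)`: large enough for `half-inBox`, and small
  -- enough that the squared side of the box is at most `9 * D * (k + k)`. The estimate is squared
  -- once more so that only the squared side occurs.
  returns-lower : ∀ {d} {S : List (Vec PM (suc d))} → Symmetric S → ∀ k → 1 ≤ k →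
                  length S ^ (2 * (k + k)) ≤
                  16 * (9 * suc d) ^ suc d * (returns S k * returns S k * (k + k) ^ suc d)
  returns-lower {d} {S} symS k k≥1 with √ (2 * (k * suc d))
  ... | R , R²≤ , <[1+R]² = begin
    length S ^ (2 * (k + k))                     ≡⟨ power ⟩
    T * T * (T * T)                              ≤⟨ *-mono-≤ T²≤ T²≤ ⟩
    4 * (B ^ D * Z) * (4 * (B ^ D * Z))          ≡⟨ e₁ (B ^ D) Z ⟩
    16 * (B ^ D * B ^ D) * (Z * Z)               ≡⟨ cong (λ r → 16 * r * (Z * Z)) (^-distribʳ-* D B B) ⟨
    16 * (B * B) ^ D * (Z * Z)                   ≤⟨ *-monoˡ-≤ (Z * Z) (*-monoʳ-≤ 16 (^-monoˡ-≤ D B²≤)) ⟩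
    16 * (9 * D * (k + k)) ^ D * (Z * Z)         ≡⟨ cong (λ r → 16 * r * (Z * Z)) (^-distribʳ-* D (9 * D) (k + k)) ⟩
    16 * ((9 * D) ^ D * (k + k) ^ D) * (Z * Z)   ≡⟨ e₂ ((9 * D) ^ D) ((k + k) ^ D) (Z * Z) ⟩
    16 * (9 * D) ^ D * (Z * Z * (k + k) ^ D)     ∎
    where
    open ≤-Reasoning
    D T Z B I : ℕ
    D = suc d
    T = length S ^ k
    Z = returns S k
    B = 1 + 2 * R
    I = walks S (inBox R) k origin
    e₁ : ∀ b z → 4 * (b * z) * (4 * (b * z)) ≡ 16 * (b * b) * (z * z)
    e₁ = solve-∀
    e₂ : ∀ a b c → 16 * (a * b) * c ≡ 16 * a * (c * b)
    e₂ = solve-∀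
    e₃ : ∀ i → 2 * i * (2 * i) ≡ 4 * (i * i)
    e₃ = solve-∀
    power : length S ^ (2 * (k + k)) ≡ T * T * (T * T)
    power rewrite +-identityʳ (k + k) | ^-distribˡ-+-* (length S) (k + k) (k + k)
                | ^-distribˡ-+-* (length S) k k = refl
    T²≤ : T * T ≤ 4 * (B ^ D * Z)
    T²≤ = begin
      T * T               ≤⟨ *-mono-≤ (half-inBox symS R k (<⇒≤ <[1+R]²)) (half-inBox symS R k (<⇒≤ <[1+R]²)) ⟩
      2 * I * (2 * I)     ≡⟨ e₃ I ⟩
      4 * (I * I)         ≤⟨ *-monoʳ-≤ 4 (inBox²≤returns symS R k) ⟩
      4 * (B ^ D * Z)     ∎
    R≥1 : ∀ R → 2 * (k * D) < (1 + R) * (1 + R) → 1 ≤ R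
    R≥1 (suc R) _ = s≤s z≤n
    R≥1 zero (s≤s le) with () ← ≤-trans (*-mono-≤ (≤-refl {2}) (*-mono-≤ k≥1 (s≤s (z≤n {d})))) le
    -- Absorbing the 1 of `1 + 2 * R` requires `R ≥ 1`, which holds because `k ≥ 1`.
    B≤ : B ≤ 3 * R
    B≤ = +-monoˡ-≤ (2 * R) (R≥1 R <[1+R]²)
    e₄ : ∀ R → 3 * R * (3 * R) ≡ 9 * (R * R)
    e₄ = solve-∀
    e₅ : ∀ k D → 9 * (2 * (k * D)) ≡ 9 * D * (k + k)
    e₅ = solve-∀
    B²≤ : B * B ≤ 9 * D * (k + k)
    B²≤ = begin
      B * B                 ≤⟨ *-mono-≤ B≤ B≤ ⟩
      3 * R * (3 * R)       ≡⟨ e₄ R ⟩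
      9 * (R * R)           ≤⟨ *-monoʳ-≤ 9 R²≤ ⟩
      9 * (2 * (k * D))     ≡⟨ e₅ k D ⟩
      9 * D * (k + k)       ∎

  -- Columns as steps

  even⊎odd : ∀ n → ∃ λ k → n ≡ k + k ⊎ n ≡ suc (k + k)
  even⊎odd zero = 0 , inj₁ refl
  even⊎odd (suc n) with even⊎odd n
  ... | k , inj₁ eq = k , inj₂ (cong suc eq)
  ... | k , inj₂ eq = suc k , inj₁ (cong suc (trans eq (sym (+-suc k k))))

  -- `A` stands for `α m`, and `S` for the columns themselves or, for even `m`, their tails.
  -- Hypothesis `odd` expresses that a closed walk followed by any one step is still counted.
  walk-bounds : ∀ {d} (S : List (Vec PM (suc d))) → Symmetric S → Flippable S → (A : ℕ → ℕ) →
    (∀ n → A n ≤ walks S small n origin) →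
    (∀ k → returns S k ≤ A (k + k)) →
    (∀ k → length S * returns S k ≤ A (suc (k + k))) →
    ∃₂ λ C₁ C₂ → ∀ n → n ≥ 2 →
      length S ^ (2 * n) ≤ C₁ * (A n ^ 2 * n ^ suc d) × A n ^ 2 * n ^ suc d ≤ C₂ * length S ^ (2 * n)
  walk-bounds {d} S symS flip A upper even odd = C₁ , C₂ , λ n n≥2 → lower n n≥2 , upper′ n
    where
    open ≤-Reasoning
    D s C₁ a C₂ : ℕ
    D = suc d
    s = length S
    C₁ = 16 * (9 * D) ^ D
    a = length (proj₁ (proj₂ (flip zero)))
    C₂ = D ^ D * (3 * (1 + a)) ^ D
    s≡2+a : s ≡ 2 + a
    s≡2+a = ↭-length (proj₂ (proj₂ (flip zero)))
    squared : ∀ x → x ^ 2 ≡ x * x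
    squared x = cong (x *_) (*-identityʳ x)
    upper′ : ∀ n → A n ^ 2 * n ^ D ≤ C₂ * s ^ (2 * n)
    upper′ n = begin
      A n ^ 2 * n ^ D           ≡⟨ cong (_* n ^ D) (squared (A n)) ⟩
      A n * A n * n ^ D         ≤⟨ *-monoˡ-≤ (n ^ D) (*-mono-≤ (upper n) (upper n)) ⟩
      walks S small n origin * walks S small n origin * n ^ D ≤⟨ walks-upper S flip s≡2+a n origin ⟩
      C₂ * (2 + a) ^ (2 * n)    ≡⟨ cong (λ r → C₂ * r ^ (2 * n)) s≡2+a ⟨
      C₂ * s ^ (2 * n)          ∎
    half≥1 : ∀ k → 2 ≤ suc (k + k) → 1 ≤ k
    half≥1 zero    (s≤s ())
    half≥1 (suc k) _ = s≤s z≤n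
    e : ∀ s c z p → s * (s * (c * (z * z * p))) ≡ c * (s * z * (s * z) * p)
    e = solve-∀
    -- The bound `n ≥ 2` gives `k ≥ 1` for both parities of `n`.
    lower : ∀ n → n ≥ 2 → s ^ (2 * n) ≤ C₁ * (A n ^ 2 * n ^ D)
    lower n n≥2 with even⊎odd n
    ... | k , inj₁ refl = begin
      s ^ (2 * (k + k))                                    ≤⟨ returns-lower {S = S} symS k (half≥1 k (m≤n⇒m≤1+n n≥2)) ⟩
      C₁ * (returns S k * returns S k * (k + k) ^ D)       ≤⟨ *-monoʳ-≤ C₁ (*-monoˡ-≤ ((k + k) ^ D) (*-mono-≤ (even k) (even k))) ⟩
      C₁ * (A (k + k) * A (k + k) * (k + k) ^ D)           ≡⟨ cong (λ r → C₁ * (r * (k + k) ^ D)) (squared (A (k + k))) ⟨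
      C₁ * (A (k + k) ^ 2 * (k + k) ^ D)                   ∎
    ... | k , inj₂ refl = begin
      s ^ (2 * suc (k + k))                                ≡⟨ cong (s ^_) (*-suc 2 (k + k)) ⟩
      s * (s * s ^ (2 * (k + k)))                          ≤⟨ *-monoʳ-≤ s (*-monoʳ-≤ s (returns-lower {S = S} symS k (half≥1 k n≥2))) ⟩
      s * (s * (C₁ * (Z * Z * (k + k) ^ D)))               ≡⟨ e s C₁ Z ((k + k) ^ D) ⟩
      C₁ * (s * Z * (s * Z) * (k + k) ^ D)                 ≤⟨ *-monoʳ-≤ C₁ (*-mono-≤ (*-mono-≤ (odd k) (odd k)) (^-monoˡ-≤ D (n≤1+n (k + k)))) ⟩
      C₁ * (A n * A n * n ^ D)                             ≡⟨ cong (λ r → C₁ * (r * n ^ D)) (squared (A n)) ⟨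
      C₁ * (A n ^ 2 * n ^ D)                               ∎
      where
      Z : ℕ
      Z = returns S k

  ∑-allVecs-negate : ∀ m (f : Vec PM m → ℕ) → ∑ (allVecs signs m) (f ∘ negate) ≡ ∑ (allVecs signs m) f
  ∑-allVecs-negate zero    f = refl
  ∑-allVecs-negate (suc m) f = begin
    ∑ (allVecs signs (suc m)) (f ∘ negate)             ≡⟨ ∑-allVecs signs m (f ∘ negate) ⟩
    ∑ signs (λ p → ∑ Vs (λ v → f (opposite p ∷ negate v)))
      ≡⟨ ∑-cong signs (λ p → ∑-allVecs-negate m (λ v → f (opposite p ∷ v))) ⟩
    ∑ Vs (λ v → f (minus1 ∷ v)) + (∑ Vs (λ v → f (plus1 ∷ v)) + 0)
      ≡⟨ e (∑ Vs (λ v → f (minus1 ∷ v))) (∑ Vs (λ v → f (plus1 ∷ v))) ⟩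
    ∑ Vs (λ v → f (plus1 ∷ v)) + (∑ Vs (λ v → f (minus1 ∷ v)) + 0)
      ≡⟨ ∑-allVecs signs m f ⟨
    ∑ (allVecs signs (suc m)) f                        ∎
    where
    open ≡-Reasoning
    Vs : List (Vec PM m)
    Vs = allVecs signs m
    e : ∀ a b → a + (b + 0) ≡ b + (a + 0)
    e = solve-∀

  vsum-negate : ∀ {n} (v : Vec PM n) → vsum (negate v) ≡ ℤ.- vsum v
  vsum-negate []           = refl
  vsum-negate (plus1 ∷ v)  = trans (cong (λ r → ℤ.-1ℤ ℤ.+ r) (vsum-negate v)) (sym (ℤ.neg-distrib-+ 1ℤ (vsum v)))
  vsum-negate (minus1 ∷ v) = trans (cong (λ r → 1ℤ ℤ.+ r) (vsum-negate v)) (sym (ℤ.neg-distrib-+ ℤ.-1ℤ (vsum v)))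

  ∣vsum-negate∣ : ∀ {n} (v : Vec PM n) → ∣ vsum (negate v) ∣ ≡ ∣ vsum v ∣
  ∣vsum-negate∣ v = trans (cong ∣_∣ (vsum-negate v)) (ℤ.∣-i∣≡∣i∣ (vsum v))

  columns-symmetric : ∀ m → Symmetric (columns m)
  columns-symmetric m f = begin
    ∑ (columns m) (f ∘ negate)
      ≡⟨ ∑-filter smallSum? Vs (f ∘ negate) ⟩
    ∑ Vs (λ v → [ smallSum? v ]¹ * f (negate v))
      ≡⟨ ∑-cong Vs (λ v → cong (λ r → [ r ≤? 1 ]¹ * f (negate v)) (∣vsum-negate∣ v)) ⟨
    ∑ Vs (λ v → [ smallSum? (negate v) ]¹ * f (negate v))
      ≡⟨ ∑-allVecs-negate m (λ v → [ smallSum? v ]¹ * f v) ⟩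
    ∑ Vs (λ v → [ smallSum? v ]¹ * f v)
      ≡⟨ ∑-filter smallSum? Vs f ⟨
    ∑ (columns m) f ∎
    where
    open ≡-Reasoning
    Vs : List (Vec PM m)
    Vs = allVecs signs m

  -- The steps that remain when the redundant first coordinate is dropped. As a list it keeps the
  -- length of `columns (suc m)`.
  tails : ∀ m → List (Vec PM m)
  tails m = map tail (columns (suc m))

  tails-symmetric : ∀ m → Symmetric (tails m)
  tails-symmetric m f = begin
    ∑ (tails m) (f ∘ negate)                          ≡⟨ ∑-map tail (columns (suc m)) (f ∘ negate) ⟩
    ∑ (columns (suc m)) (f ∘ negate ∘ tail)           ≡⟨ ∑-cong (columns (suc m)) (λ { (p ∷ v) → refl }) ⟩
    ∑ (columns (suc m)) (f ∘ tail ∘ negate)           ≡⟨ columns-symmetric (suc m) (f ∘ tail) ⟩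
    ∑ (columns (suc m)) (f ∘ tail)                    ≡⟨ ∑-map tail (columns (suc m)) f ⟨
    ∑ (tails m) f                                     ∎
    where open ≡-Reasoning

  ∈-signs : ∀ p → p ∈ signs
  ∈-signs plus1  = here refl
  ∈-signs minus1 = there (here refl)

  ∈-allVecs : ∀ {m} (v : Vec PM m) → v ∈ allVecs signs m
  ∈-allVecs []                = here refl
  ∈-allVecs {suc m} (p ∷ v) =
    ∈-concat⁺′ (∈-map⁺ (p ∷_) (∈-allVecs v)) (∈-map⁺ (λ q → map (q ∷_) (allVecs signs m)) (∈-signs p))

  ∈-columns : ∀ {m} (v : Vec PM m) → SmallSum v → v ∈ columns m
  ∈-columns v small-v = ∈-filter⁺ smallSum? (∈-allVecs v) small-v

  -- Distinct values occupy distinct positions, so the second member survives the removal of the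
  -- first.
  two-members : {A : Set} {xs : List A} {v w : A} → v ∈ xs → w ∈ xs → v ≢ w → ∃ λ rest → xs ↭ v ∷ w ∷ rest
  two-members {v = v} {w} v∈ w∈ v≢w with ∈-∃++ v∈
  ... | ys , zs , refl with ∈-resp-↭ (↭-shift v ys zs) w∈
  ...   | here w≡v  = ⊥-elim (v≢w (sym w≡v))
  ...   | there w∈′ with ys′ , zs′ , eq ← ∈-∃++ w∈′ = ys′ ++ zs′ ,
    ↭-trans (↭-shift v ys zs) (↭-prep v (subst (_↭ w ∷ ys′ ++ zs′) (sym eq) (↭-shift w ys′ zs′)))

  vsum-insertAt : ∀ {n} (w : Vec PM n) i p → vsum (insertAt w i p) ≡ val p ℤ.+ vsum w
  vsum-insertAt w       zero    p = refl
  vsum-insertAt (q ∷ w) (suc i) p = trans (cong (λ r → val q ℤ.+ r) (vsum-insertAt w i p)) (e (val q) (val p) (vsum w))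
    where
    e : ∀ a b c → a ℤ.+ (b ℤ.+ c) ≡ b ℤ.+ (a ℤ.+ c)
    e = ℤ-solve-∀

  balanced : ∀ h → ∃ λ (w : Vec PM (2 * h)) → vsum w ≡ 0ℤ
  balanced zero = [] , refl
  balanced (suc h) with balanced h
  ... | w , eq = subst (λ n → ∃ λ (w : Vec PM n) → vsum w ≡ 0ℤ) (sym (*-suc 2 h))
    (plus1 ∷ minus1 ∷ w , cong (λ r → 1ℤ ℤ.+ (ℤ.-1ℤ ℤ.+ r)) eq)

  insertAt-≢ : ∀ {n} (w : Vec PM n) i → insertAt w i plus1 ≢ insertAt w i minus1
  insertAt-≢ w i eq with () ← trans (sym (insertAt-lookup w i plus1))
                                (trans (cong (λ v → lookup v i) eq) (insertAt-lookup w i minus1))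

  ∣val∣≤1 : ∀ p → ∣ val p ∣ ≤ 1
  ∣val∣≤1 plus1  = ≤-refl
  ∣val∣≤1 minus1 = ≤-refl

  -- A sign inserted into a zero-sum vector gives the sum 1 or -1, so both choices are admissible at
  -- every position.
  columns-flippable : ∀ h → Flippable (columns (suc (2 * h)))
  columns-flippable h i with w , w≡0 ← balanced h =
    w , two-members (member plus1) (member minus1) (insertAt-≢ w i)
    where
    member : ∀ p → insertAt w i p ∈ columns (suc (2 * h))
    member p = ∈-columns (insertAt w i p) (subst (λ r → ∣ r ∣ ≤ 1)
      (sym (trans (vsum-insertAt w i p) (trans (cong (λ r → val p ℤ.+ r) w≡0) (ℤ.+-identityʳ (val p))))) (∣val∣≤1 p))

  -- The dropped entry is chosen opposite to the inserted sign, which makes the sum of the full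
  -- column zero.
  tails-flippable : ∀ h → Flippable (tails (suc (2 * h)))
  tails-flippable h i with w , w≡0 ← balanced h =
    w , two-members (member plus1) (member minus1) (insertAt-≢ w i)
    where
    cancel : ∀ p → val (opposite p) ℤ.+ (val p ℤ.+ 0ℤ) ≡ 0ℤ
    cancel plus1  = refl
    cancel minus1 = refl
    member : ∀ p → insertAt w i p ∈ tails (suc (2 * h))
    member p = ∈-map⁺ tail (∈-columns (opposite p ∷ insertAt w i p) (subst (λ r → ∣ r ∣ ≤ 1)
      (sym (trans (cong (λ r → val (opposite p) ℤ.+ r) (trans (vsum-insertAt w i p) (cong (λ r → val p ℤ.+ r) w≡0))) (cancel p)))
      z≤n))

  -- One step away from the origin every coordinate is 1 or -1; this serves the matrices with an odd
  -- number of columns.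
  at≤small-step : ∀ {d} (y : Vec ℤ d) v → at origin y ≤ small (y ⊕ v)
  at≤small-step []      []      = ≤-refl
  at≤small-step (z ∷ y) (p ∷ v) with 0ℤ ℤ.≟ z
  ... | no _     = z≤n
  ... | yes refl rewrite ℤ.+-identityˡ (val p) with p
  ...   | plus1  = +-monoˡ-≤ 0 (at≤small-step y v)
  ...   | minus1 = +-monoˡ-≤ 0 (at≤small-step y v)

  at≤small : ∀ {d} (y : Vec ℤ d) → at origin y ≤ small y
  at≤small []      = ≤-refl
  at≤small (z ∷ y) with 0ℤ ℤ.≟ z
  ... | no _     = z≤n
  ... | yes refl = +-monoˡ-≤ 0 (at≤small y)

  α-lower : ∀ m n → walks (columns m) (at origin) n origin ≤ α m n
  α-lower m n = ≤-trans (walks-mono (columns m) at≤small n origin) (≤-reflexive (sym (α-walks m n)))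

  α-suc-lower : ∀ m n → length (columns m) * walks (columns m) (at origin) n origin ≤ α m (suc n)
  α-suc-lower m n = begin
    length S * walks S (at origin) n origin            ≡⟨ walks-*ˡ S (length S) (at origin) n origin ⟨
    walks S (λ y → length S * at origin y) n origin
      ≤⟨ walks-mono S (λ y → ≤-trans (≤-reflexive (sym (∑-const S _))) (∑-mono S (at≤small-step y))) n origin ⟩
    walks S (walks S small 1) n origin                 ≡⟨ walks-+-steps S small n 1 origin ⟨
    walks S small (n + 1) origin                       ≡⟨ cong (λ r → walks S small r origin) (+-comm n 1) ⟩
    walks S small (suc n) origin                       ≡⟨ α-walks m (suc n) ⟨
    α m (suc n)                                        ∎
    where
    open ≤-Reasoning
    S : List (Vec PM m)
    S = columns m

  -- Projection along the first coordinate

  tail-⊕ : ∀ {d} (y : Vec ℤ (suc d)) v → tail (y ⊕ v) ≡ tail y ⊕ tail v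
  tail-⊕ (z ∷ y) (p ∷ v) = refl

  -- Dropping a coordinate discards one condition on the endpoint, so the count can only grow.
  tails-upper : ∀ m n (y : Vec ℤ (suc m)) → walks (columns (suc m)) small n y ≤ walks (tails m) small n (tail y)
  tails-upper m zero (z ∷ y) = ≤-trans (*-monoˡ-≤ (small y) (u₀≤1 ∣ z ∣)) (≤-reflexive (+-identityʳ (small y)))
    where
    u₀≤1 : ∀ k → u 0 k ≤ 1
    u₀≤1 k with k ≤? 1
    ... | yes _ = ≤-refl
    ... | no  _ = z≤n
  tails-upper m (suc n) y = begin
    ∑ (columns (suc m)) (λ v → walks (columns (suc m)) small n (y ⊕ v))     ≤⟨ ∑-mono (columns (suc m)) (λ v → tails-upper m n (y ⊕ v)) ⟩
    ∑ (columns (suc m)) (λ v → walks (tails m) small n (tail (y ⊕ v)))      ≡⟨ ∑-cong (columns (suc m)) (λ v → cong (walks (tails m) small n) (tail-⊕ y v)) ⟩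
    ∑ (columns (suc m)) (λ v → walks (tails m) small n (tail y ⊕ tail v))   ≡⟨ ∑-map tail (columns (suc m)) _ ⟨
    ∑ (tails m) (λ v → walks (tails m) small n (tail y ⊕ v))                ∎
    where
    open ≤-Reasoning

  vsum-parity : ∀ {n} (v : Vec PM n) → ∃ λ q → vsum v ≡ ℤ.+ n ℤ.+ ℤ.+ 2 ℤ.* q
  vsum-parity [] = 0ℤ , refl
  vsum-parity {suc n} (plus1 ∷ v) with q , eq ← vsum-parity v =
    q , trans (cong (λ r → 1ℤ ℤ.+ r) eq) (sym (ℤ.+-assoc 1ℤ (ℤ.+ n) (ℤ.+ 2 ℤ.* q)))
  vsum-parity {suc n} (minus1 ∷ v) with q , eq ← vsum-parity v =
    q ℤ.- 1ℤ , trans (cong (λ r → ℤ.-1ℤ ℤ.+ r) eq) (e (ℤ.+ n) q)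
    where
    e : ∀ m q → ℤ.-1ℤ ℤ.+ (m ℤ.+ ℤ.+ 2 ℤ.* q) ≡ 1ℤ ℤ.+ m ℤ.+ ℤ.+ 2 ℤ.* (q ℤ.- 1ℤ)
    e = ℤ-solve-∀

  even-small⇒0 : ∀ h (v : Vec PM (2 * h)) → SmallSum v → vsum v ≡ 0ℤ
  even-small⇒0 h v small-v with q , eq ← vsum-parity v = begin
    vsum v                  ≡⟨ factor ⟩
    ℤ.+ 2 ℤ.* r             ≡⟨ cong (ℤ.+ 2 ℤ.*_) (ℤ.∣i∣≡0⇒i≡0 (half ∣ r ∣ (subst (_≤ 1) (trans (cong ∣_∣ factor) (ℤ.abs-* (ℤ.+ 2) r)) small-v))) ⟩
    0ℤ                      ∎
    where
    open ≡-Reasoning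
    r : ℤ
    r = ℤ.+ h ℤ.+ q
    factor : vsum v ≡ ℤ.+ 2 ℤ.* r
    factor = trans eq (trans (cong (λ m → m ℤ.+ ℤ.+ 2 ℤ.* q) (ℤ.pos-* 2 h)) (sym (ℤ.*-distribˡ-+ (ℤ.+ 2) (ℤ.+ h) q)))
    half : ∀ k → 2 * k ≤ 1 → k ≡ 0
    half zero    _ = refl
    half (suc k) le with s≤s () ← subst (_≤ 1) (*-suc 2 k) le

  total : ∀ {d} → Vec ℤ d → ℤ
  total []      = 0ℤ
  total (z ∷ x) = z ℤ.+ total x

  total-⊕ : ∀ {d} (x : Vec ℤ d) v → total (x ⊕ v) ≡ total x ℤ.+ vsum v
  total-⊕ []      []      = refl
  total-⊕ (z ∷ x) (p ∷ v) = trans (cong (λ r → z ℤ.+ val p ℤ.+ r) (total-⊕ x v)) (e z (val p) (total x) (vsum v))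
    where
    e : ∀ a b c d → a ℤ.+ b ℤ.+ (c ℤ.+ d) ≡ a ℤ.+ c ℤ.+ (b ℤ.+ d)
    e = ℤ-solve-∀

  total-origin : ∀ d → total (origin {d}) ≡ 0ℤ
  total-origin zero    = refl
  total-origin (suc d) = trans (ℤ.+-identityˡ (total (origin {d}))) (total-origin d)

  ∑-filter-mono : {A : Set} {P : A → Set} (P? : ∀ x → Dec (P x)) (xs : List A) {f g : A → ℕ} →
                  (∀ x → P x → f x ≤ g x) → ∑ (filter P? xs) f ≤ ∑ (filter P? xs) g
  ∑-filter-mono P? []       le = z≤n
  ∑-filter-mono P? (x ∷ xs) le with P? x
  ... | yes p = +-mono-≤ (le x p) (∑-filter-mono P? xs le)
  ... | no  _ = ∑-filter-mono P? xs le

  -- A step with zero sum keeps the total of the coordinates, so the first one vanishes with the others.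
  tails-lower : ∀ m h → suc m ≡ 2 * h → ∀ n (y : Vec ℤ (suc m)) → total y ≡ 0ℤ →
                walks (tails m) (at origin) n (tail y) ≤ walks (columns (suc m)) (at origin) n y
  tails-lower m h even zero (z ∷ x) y≡0 = ≤-reflexive (begin
    at origin x                               ≡⟨ *-identityʳ (at origin x) ⟨
    -- An indicator that is true at the origin is inserted, and `at-subst` evaluates it at `x`
    -- instead; there it says that `z`, the negative of `total x`, vanishes.
    at origin x * 1                           ≡⟨ cong (at origin x *_) ([]¹-yes (0ℤ ℤ.≟ ℤ.- total origin₀) (cong (λ r → ℤ.- r) (sym (total-origin m)))) ⟨
    at origin x * [ 0ℤ ℤ.≟ ℤ.- total origin₀ ]¹ ≡⟨ at-subst origin x (λ e → [ 0ℤ ℤ.≟ ℤ.- total e ]¹) ⟩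
    at origin x * [ 0ℤ ℤ.≟ ℤ.- total x ]¹     ≡⟨ cong (λ r → at origin x * [ 0ℤ ℤ.≟ r ]¹) z≡ ⟨
    at origin x * [ 0ℤ ℤ.≟ z ]¹               ≡⟨ *-comm (at origin x) _ ⟩
    [ 0ℤ ℤ.≟ z ]¹ * at origin x               ∎)
    where
    open ≡-Reasoning
    origin₀ : Vec ℤ m
    origin₀ = origin
    e : ∀ z t → z ≡ z ℤ.+ t ℤ.+ ℤ.- t
    e = ℤ-solve-∀
    z≡ : z ≡ ℤ.- total x
    z≡ = trans (e z (total x)) (trans (cong (λ r → r ℤ.+ ℤ.- total x) y≡0) (ℤ.+-identityˡ _))
  tails-lower m h even (suc n) y y≡0 = begin
    ∑ (tails m) (λ v → walks (tails m) (at origin) n (tail y ⊕ v))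
      ≡⟨ ∑-map tail (columns (suc m)) _ ⟩
    ∑ (columns (suc m)) (λ v → walks (tails m) (at origin) n (tail y ⊕ tail v))
      ≡⟨ ∑-cong (columns (suc m)) (λ v → cong (walks (tails m) (at origin) n) (tail-⊕ y v)) ⟨
    ∑ (columns (suc m)) (λ v → walks (tails m) (at origin) n (tail (y ⊕ v)))
      ≤⟨ ∑-filter-mono smallSum? (allVecs signs (suc m)) (λ v small-v → tails-lower m h even n (y ⊕ v) (stays v small-v)) ⟩
    ∑ (columns (suc m)) (λ v → walks (columns (suc m)) (at origin) n (y ⊕ v)) ∎
    where
    open ≤-Reasoning
    vanish : ∀ {k} (v : Vec PM k) → k ≡ 2 * h → SmallSum v → vsum v ≡ 0ℤ
    vanish v refl = even-small⇒0 h v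
    stays : ∀ v → SmallSum v → total (y ⊕ v) ≡ 0ℤ
    stays v small-v = trans (total-⊕ y v) (cong₂ ℤ._+_ y≡0 (vanish v even small-v))

  α-bounds-odd : ∀ h → let m = suc (2 * h) in
    ∃₂ λ C₁ C₂ → ∀ n → n ≥ 2 →
      α m 1 ^ (2 * n) ≤ C₁ * (α m n ^ 2 * n ^ suc (2 * h)) × α m n ^ 2 * n ^ suc (2 * h) ≤ C₂ * α m 1 ^ (2 * n)
  α-bounds-odd h rewrite α-one (suc (2 * h)) =
    walk-bounds (columns m) (columns-symmetric m) (columns-flippable h) (α m)
      (λ n → ≤-reflexive (α-walks m n)) (λ k → α-lower m (k + k)) (λ k → α-suc-lower m (k + k))
    where
    m : ℕ
    m = suc (2 * h)

  α-bounds-even : ∀ h → let m = suc (suc (2 * h)) in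
    ∃₂ λ C₁ C₂ → ∀ n → n ≥ 2 →
      α m 1 ^ (2 * n) ≤ C₁ * (α m n ^ 2 * n ^ suc (2 * h)) × α m n ^ 2 * n ^ suc (2 * h) ≤ C₂ * α m 1 ^ (2 * n)
  α-bounds-even h rewrite trans (α-one (suc (suc (2 * h)))) (sym (length-map tail (columns (suc (suc (2 * h)))))) =
    walk-bounds (tails d) (tails-symmetric d) (tails-flippable h) (α m)
      (λ n → ≤-trans (≤-reflexive (α-walks m n)) (tails-upper d n origin))
      (λ k → ≤-trans (returns≤ k) (α-lower m (k + k)))
      (λ k → ≤-trans (*-mono-≤ (≤-reflexive (length-map tail (columns m))) (returns≤ k)) (α-suc-lower m (k + k)))
    where
    d m : ℕ
    d = suc (2 * h)
    m = suc d
    returns≤ : ∀ k → returns (tails d) k ≤ walks (columns m) (at origin) (k + k) origin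
    returns≤ k = tails-lower d (suc h) (sym (*-suc 2 h)) (k + k) origin (total-origin m)

  -- Rational constants and the assembled bounds

  fromℚᵘ-mono-≤ : ∀ p q → p ℚᵘ.≤ q → fromℚᵘ p ℚ.≤ fromℚᵘ q
  fromℚᵘ-mono-≤ p q p≤q = ℚ.toℚᵘ-cancel-≤
    (ℚᵘ.≤-respˡ-≃ (ℚᵘ.≃-sym (ℚ.toℚᵘ-fromℚᵘ p)) (ℚᵘ.≤-respʳ-≃ (ℚᵘ.≃-sym (ℚ.toℚᵘ-fromℚᵘ q)) p≤q))

  fromℚᵘ-homo-* : ∀ p q → fromℚᵘ p ℚ.* fromℚᵘ q ≡ fromℚᵘ (p ℚᵘ.* q)
  fromℚᵘ-homo-* p q = ℚ.toℚᵘ-injective (ℚᵘ.≃-trans (ℚ.toℚᵘ-homo-* (fromℚᵘ p) (fromℚᵘ q))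
    (ℚᵘ.≃-trans (ℚᵘ.*-cong (ℚ.toℚᵘ-fromℚᵘ p) (ℚ.toℚᵘ-fromℚᵘ q)) (ℚᵘ.≃-sym (ℚ.toℚᵘ-fromℚᵘ (p ℚᵘ.* q)))))

  square*-fromℚᵘ : ∀ p q → fromℚᵘ p ℚ.* fromℚᵘ p ℚ.* fromℚᵘ q ≡ fromℚᵘ (p ℚᵘ.* p ℚᵘ.* q)
  square*-fromℚᵘ p q = trans (cong (λ r → r ℚ.* fromℚᵘ q) (fromℚᵘ-homo-* p p)) (fromℚᵘ-homo-* (p ℚᵘ.* p) q)

  -- The rational constants enter squared, and `suc n` squared dominates `n`; this replaces
  -- extracting a square root and keeps the constants nonzero.
  m≤[1+n]²*m : ∀ n m → n * m ≤ suc n * suc n * m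
  m≤[1+n]²*m n m = *-monoˡ-≤ m (≤-trans (n≤1+n n) (m≤m*n (suc n) (suc n)))

  -- `mkℚᵘ` stores the denominator minus one, so the value is 1 / (1 + K).
  reciprocal : ℕ → ℚ
  reciprocal K = fromℚᵘ (mkℚᵘ 1ℤ K)

  lower-constant : ∀ K {X Y} → X ≤ K * Y →
    let c = reciprocal K in c ℚ.* c ℚ.* ℕtoℚ X ℚ.≤ ℕtoℚ Y
  lower-constant K {X} {Y} X≤KY = subst (λ r → r ℚ.≤ ℕtoℚ Y) (sym (square*-fromℚᵘ (mkℚᵘ 1ℤ K) (mkℚᵘ (ℤ.+ X) 0)))
    (fromℚᵘ-mono-≤ (mkℚᵘ 1ℤ K ℚᵘ.* mkℚᵘ 1ℤ K ℚᵘ.* mkℚᵘ (ℤ.+ X) 0) (mkℚᵘ (ℤ.+ Y) 0) (*≤* (begin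
      1ℤ ℤ.* 1ℤ ℤ.* ℤ.+ X ℤ.* 1ℤ              ≡⟨ e (ℤ.+ X) ⟩
      ℤ.+ X                                   ≤⟨ ℤ.+≤+ (≤-trans X≤KY (m≤[1+n]²*m K Y)) ⟩
      ℤ.+ (suc K * suc K * Y)                 ≡⟨ cong ℤ.+_ (f (suc K) Y) ⟩
      ℤ.+ (Y * (suc K * suc K * 1))           ≡⟨ ℤ.pos-* Y (suc K * suc K * 1) ⟩
      ℤ.+ Y ℤ.* ℤ.+ (suc K * suc K * 1)       ∎)))
    where
    open ℤ.≤-Reasoning
    e : ∀ x → 1ℤ ℤ.* 1ℤ ℤ.* x ℤ.* 1ℤ ≡ x
    e = ℤ-solve-∀
    f : ∀ c y → c * c * y ≡ y * (c * c * 1)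
    f = solve-∀

  upper-constant : ∀ K {X Y} → Y ≤ K * X → ℕtoℚ Y ℚ.≤ ℕtoℚ (suc K) ℚ.* ℕtoℚ (suc K) ℚ.* ℕtoℚ X
  upper-constant K {X} {Y} Y≤KX = subst (λ r → ℕtoℚ Y ℚ.≤ r) (sym (square*-fromℚᵘ (mkℚᵘ (ℤ.+ suc K) 0) (mkℚᵘ (ℤ.+ X) 0)))
    (fromℚᵘ-mono-≤ (mkℚᵘ (ℤ.+ Y) 0) (mkℚᵘ (ℤ.+ suc K) 0 ℚᵘ.* mkℚᵘ (ℤ.+ suc K) 0 ℚᵘ.* mkℚᵘ (ℤ.+ X) 0) (*≤* (begin
      ℤ.+ Y ℤ.* 1ℤ                            ≡⟨ ℤ.*-identityʳ (ℤ.+ Y) ⟩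
      ℤ.+ Y                                   ≤⟨ ℤ.+≤+ (≤-trans Y≤KX (m≤[1+n]²*m K X)) ⟩
      ℤ.+ (suc K * suc K * X)                 ≡⟨ ℤ.pos-* (suc K * suc K) X ⟩
      ℤ.+ (suc K * suc K) ℤ.* ℤ.+ X           ≡⟨ ℤ.*-identityʳ _ ⟨
      ℤ.+ (suc K * suc K) ℤ.* ℤ.+ X ℤ.* 1ℤ    ∎)))
    where
    open ℤ.≤-Reasoning

  0<lower-constant : ∀ K → 0ℚ ℚ.< reciprocal K
  0<lower-constant K = ℚ.positive⁻¹ (reciprocal K) {{ℚ.normalize-pos 1 (suc K)}}

  lower≤upper-constant : ∀ C₁ C₂ → reciprocal C₁ ℚ.≤ ℕtoℚ (suc C₂)
  lower≤upper-constant C₁ C₂ = fromℚᵘ-mono-≤ (mkℚᵘ 1ℤ C₁) (mkℚᵘ (ℤ.+ suc C₂) 0) (*≤* (ℤ.+≤+ (s≤s z≤n)))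

  -- Squaring clears the half in the exponent of `n`: `e` is twice ⌊(m - 1)/2⌋ + 1/2, the dimension
  -- of the walk.
  α-bounds : ∀ m → m ≥ 1 → let e = 2 * ((m ∸ 1) / 2) + 1 in
    ∃₂ λ C₁ C₂ → ∀ n → n ≥ 2 →
      α m 1 ^ (2 * n) ≤ C₁ * (α m n ^ 2 * n ^ e) × α m n ^ 2 * n ^ e ≤ C₂ * α m 1 ^ (2 * n)
  α-bounds (suc m) _ rewrite +-comm (2 * (m / 2)) 1 =
    go (m / 2) (m % 2) (m%n<n m 2) (trans (m≡m%n+[m/n]*n m 2) (cong (m % 2 +_) (*-comm (m / 2) 2)))
    where
    go : ∀ h r → r < 2 → m ≡ r + 2 * h → ∃₂ λ C₁ C₂ → ∀ n → n ≥ 2 →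
      α (suc m) 1 ^ (2 * n) ≤ C₁ * (α (suc m) n ^ 2 * n ^ suc (2 * h)) ×
      α (suc m) n ^ 2 * n ^ suc (2 * h) ≤ C₂ * α (suc m) 1 ^ (2 * n)
    -- The pattern variable `m` is one less than the number of rows, so remainder 0 is the case of
    -- oddly many rows.
    go h 0 _ refl = α-bounds-odd h
    go h 1 _ refl = α-bounds-even h
    go h (suc (suc r)) (s≤s (s≤s ()))

  -- For `2 * t ∸ 1` rows the admissible sums 1 and -1 give adjacent coefficients, which Pascal's
  -- rule merges into row `2 * t`; this is the case `s = 1` of `u-binomial`.
  α-one-binomial : ∀ t → t ≥ 1 → α (2 * t ∸ 1) 1 ≡ (2 * t) C t × α (2 * t) 1 ≡ (2 * t) C t
  α-one-binomial (suc t) _ =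
    trans (α-one (2 * suc t ∸ 1)) (trans (length-columns (2 * suc t ∸ 1)) (u-binomial 1 ≤-refl (2 * suc t ∸ 1) 0 (suc t) (+-identityʳ _))) ,
    trans (α-one (2 * suc t)) (trans (length-columns (2 * suc t)) (u-binomial 0 z≤n (2 * suc t) 0 (suc t) (+-identityʳ _)))

open import Data.Rational using (ℚ; 0ℚ; _<_; _≤_; _*_)
open import Data.Product using (_,_; proj₁; proj₂)

theorem5 : ((m : ℕ) → m ≥ 1 →
    Σ ℚ λ c₁ → Σ ℚ λ c₂ → 0ℚ < c₁ × c₁ ≤ c₂ × Σ ℕ λ N → (n : ℕ) → n ≥ N →
    (c₁ * c₁) * ℕtoℚ (α m 1 ^ (2 Data.Nat.* n))
    ≤ ℕtoℚ (α m n ^ 2 Data.Nat.* n ^ (2 Data.Nat.* ((m Data.Nat.∸ 1) / 2) Data.Nat.+ 1))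
    × ℕtoℚ (α m n ^ 2 Data.Nat.* n ^ (2 Data.Nat.* ((m Data.Nat.∸ 1) / 2) Data.Nat.+ 1))
    ≤ (c₂ * c₂) * ℕtoℚ (α m 1 ^ (2 Data.Nat.* n)))
    × ((t : ℕ) → t ≥ 1 →
    α (2 Data.Nat.* t Data.Nat.∸ 1) 1 ≡ (2 Data.Nat.* t) C t
    × α (2 Data.Nat.* t) 1 ≡ (2 Data.Nat.* t) C t)
theorem5 =
  (λ m m≥1 → let C₁ , C₂ , bounds = α-bounds m m≥1 in
    reciprocal C₁ , ℕtoℚ (suc C₂) , 0<lower-constant C₁ , lower≤upper-constant C₁ C₂ , 2 ,
    λ n n≥2 → lower-constant C₁ (proj₁ (bounds n n≥2)) , upper-constant C₂ (proj₂ (bounds n n≥2))) ,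
  α-one-binomial
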